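{- Let $k,t\ge 0$ be integers, $n=2k+t+1$, and $\alpha\in[0,1]$. Let $C^c$ be the graph with vertices $v,v_1,\dots,v_k,v_1',\dots,v_k',u_1,\dots,u_t$ consisting of the $k$ triangles $vv_iv_i'v$ ($1\le i\le k$) and the $t$ pendant edges $vu_1,\dots,vu_t$. The eigenvalues of $A_\alpha(C^c)$ are $\alpha$, $\alpha+1$ (if $k\ge 2$, otherwise none), $3\alpha-1$, and the roots of $f(\lambda)=0$, where $$f(\lambda)=(\alpha-\lambda)^3+(n\alpha-2\alpha+1)(\alpha-\lambda)^2+\big[(1-n)\alpha^2+(3n-4)\alpha+1-n\big](\alpha-\lambda)-t(1-\alpha)^2.$$
   Context: All graphs are finite and simple. For a graph $G$, let $A(G)$ be its adjacency matrix and $D(G)$ the diagonal matrix of vertex degrees. For $\alpha\in[0,1]$, $A_\alpha(G)=\alpha D(G)+(1-\alpha)A(G)$.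
   Formalization: The list as printed fails in degenerate cases (e.g. k=0, t=1, α=0): here α is listed only if t≥2, 3α−1 only if k≥1, and the root α of f when t=0 (resp. α+1 when k=0) counts only if it is a multiple root of f. -}

module Defs where

open import Algebra.Bundles using (CommutativeRing; Semiring)
import Algebra.Definitions.RawSemiring as RawSemiringDefs
open import Data.Bool.Base using (if_then_else_)
open import Data.Fin.Base using (Fin; zero; suc)
import Data.Fin.Properties as Fin
open import Data.List.Base using (List; map; filter; length; allFin)
open import Data.Nat.Base as ℕ using (ℕ)
open import Data.Product.Base using (_×_; _,_; ∃; ∃₂)
open import Data.Sum.Base using (_⊎_; inj₁; inj₂)
open import Data.Sum.Function.Propositional using (_⊎-↔_)
open import Function.Base using (_∘_)
open import Function.Bundles using (Inverse; _↔_; mk↔ₛ′)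
open import Function.Properties.Inverse using (↔-refl; ↔-sym; ↔-trans; ↔⇒↣)
open import Level using (Level; 0ℓ) renaming (suc to lsuc)
open import Relation.Binary.Construct.Closure.Symmetric using (SymClosure; fwd; bwd; symmetric)
open import Relation.Binary.Core using (Rel)
open import Relation.Binary.Definitions using (Decidable; DecidableEquality; Symmetric)
open import Relation.Binary.PropositionalEquality.Core using (_≡_; refl)
open import Relation.Binary.Structures using (IsDecTotalOrder)
open import Relation.Nullary.Decidable using (yes; no; does; map′; _⊎-dec_; via-injection)
open import Relation.Nullary.Negation using (¬_)
open import Relation.Unary using (Pred; Satisfiable)

-- The classical real numbers, given by the axioms that characterise them up to
-- isomorphism.  As usual classically, the order is decidable.
record CompleteOrderedField (ℓ : Level) : Set (lsuc ℓ) where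
  infix 4 _≤_
  field
    commutativeRing : CommutativeRing ℓ ℓ
  open CommutativeRing commutativeRing public hiding (_≉_)
  field
    _≤_             : Rel Carrier ℓ
    isDecTotalOrder : IsDecTotalOrder _≈_ _≤_
    0≉1             : ¬ (0# ≈ 1#)
    inverse         : ∀ x → ¬ (x ≈ 0#) → ∃ λ y → x * y ≈ 1#
    +-monoˡ-≤       : ∀ {x y} z → x ≤ y → x + z ≤ y + z
    *-nonNegative   : ∀ {x y} → 0# ≤ x → 0# ≤ y → 0# ≤ x * y

  IsUpperBound : Pred Carrier ℓ → Pred Carrier ℓ
  IsUpperBound P b = ∀ x → P x → x ≤ b

  field
    supremum : (P : Pred Carrier ℓ) → Satisfiable P → Satisfiable (IsUpperBound P) →
               ∃ λ s → IsUpperBound P s × (∀ b → IsUpperBound P b → s ≤ b)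

record Graph : Set₁ where
  infix 4 _~_ _~?_ _≟_
  field
    order    : ℕ
    Vertex   : Set
    enum     : Fin order ↔ Vertex
    _~_      : Rel Vertex 0ℓ
    _~?_     : Decidable _~_
    ~-sym    : Symmetric _~_
    ~-irrefl : ∀ {x} → ¬ (x ~ x)

  _≟_ : DecidableEquality Vertex
  _≟_ = via-injection (↔⇒↣ (↔-sym enum)) Fin._≟_

  vertices : List Vertex
  vertices = map (Inverse.to enum) (allFin order)

  degree : Vertex → ℕ
  degree x = length (filter (x ~?_) vertices)

module Spectral {ℓ : Level} (ℝ : CompleteOrderedField ℓ) where
  open CompleteOrderedField ℝ
  open RawSemiringDefs (Semiring.rawSemiring semiring) public using (_^_)
  open RawSemiringDefs (Semiring.rawSemiring semiring) using (sum) renaming (_×_ to _×ᵣ_)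

  ⟨_⟩ : ℕ → Carrier
  ⟨ n ⟩ = n ×ᵣ 1#

  module _ (G : Graph) where
    open Graph G

    Matrix : Set ℓ
    Matrix = Vertex → Vertex → Carrier

    adjacencyMatrix : Matrix
    adjacencyMatrix x y = if does (x ~? y) then 1# else 0#

    degreeMatrix : Matrix
    degreeMatrix x y = if does (x ≟ y) then ⟨ degree x ⟩ else 0#

    A[_] : Carrier → Matrix
    A[ α ] x y = α * degreeMatrix x y + (1# - α) * adjacencyMatrix x y

    _*ᵥ_ : Matrix → (Vertex → Carrier) → (Vertex → Carrier)
    (M *ᵥ w) x = sum (λ i → M x (Inverse.to enum i) * w (Inverse.to enum i))

    IsEigenvalue : Matrix → Carrier → Set ℓ
    IsEigenvalue M μ = ∃ λ (w : Vertex → Carrier) →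
      ¬ (∀ x → w x ≈ 0#) × (∀ x → (M *ᵥ w) x ≈ μ * w x)

  f : (n t : ℕ) (α : Carrier) → Carrier → Carrier
  f n t α μ =
      (α - μ) ^ 3
    + (⟨ n ⟩ * α - ⟨ 2 ⟩ * α + 1#) * (α - μ) ^ 2
    + ((1# - ⟨ n ⟩) * α ^ 2 + (⟨ 3 ⟩ * ⟨ n ⟩ - ⟨ 4 ⟩) * α + 1# - ⟨ n ⟩) * (α - μ)
    - ⟨ t ⟩ * (1# - α) ^ 2

  -- For a cubic g: the square of (x - μ) divides g, with a cofactor of degree at most one.
  IsMultipleRoot : (Carrier → Carrier) → Carrier → Set ℓ
  IsMultipleRoot g μ = ∃₂ λ a b → ∀ x → g x ≈ (x - μ) ^ 2 * (a * x + b)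

  -- f is the characteristic polynomial of the quotient of A_α by the partition into the
  -- centre, the triangle vertices and the leaves.  When there are no leaves (t = 0) or no
  -- triangles (k = 0), one of these cells is empty and f has gained a factor (α - μ),
  -- respectively (α + 1 - μ), that does not come from the graph; one copy of that root has
  -- to be discarded.  For k, t ≥ 1 this is just f n t α μ ≈ 0#.
  IsGenuineRoot : (k t n : ℕ) (α μ : Carrier) → Set ℓ
  IsGenuineRoot k t n α μ =
    f n t α μ ≈ 0# ×
    ((t ≡ 0 × μ ≈ α) ⊎ (k ≡ 0 × μ ≈ α + 1#) → IsMultipleRoot (f n t α) μ)

module FriendshipWithPendants (k t : ℕ) where

  data Vertex : Set where
    v  : Vertex
    v₁ : Fin k → Vertex
    v′ : Fin k → Vertex
    u  : Fin t → Vertex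

  data Edge : Rel Vertex 0ℓ where
    v-v₁  : ∀ i → Edge v (v₁ i)
    v₁-v′ : ∀ i → Edge (v₁ i) (v′ i)
    v′-v  : ∀ i → Edge (v′ i) v
    v-u   : ∀ j → Edge v (u j)

  edge? : Decidable Edge
  edge? v      v      = no λ ()
  edge? v      (v₁ i) = yes (v-v₁ i)
  edge? v      (v′ i) = no λ ()
  edge? v      (u j)  = yes (v-u j)
  edge? (v₁ i) v      = no λ ()
  edge? (v₁ i) (v₁ j) = no λ ()
  edge? (v₁ i) (v′ j) = map′ (λ { refl → v₁-v′ i }) (λ { (v₁-v′ _) → refl }) (i Fin.≟ j)
  edge? (v₁ i) (u j)  = no λ ()
  edge? (v′ i) v      = yes (v′-v i)
  edge? (v′ i) (v₁ j) = no λ ()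
  edge? (v′ i) (v′ j) = no λ ()
  edge? (v′ i) (u j)  = no λ ()
  edge? (u j)  y      = no λ ()

  adjacent? : Decidable (SymClosure Edge)
  adjacent? x y = map′ (λ { (inj₁ e) → fwd e ; (inj₂ e) → bwd e })
                       (λ { (fwd e) → inj₁ e ; (bwd e) → inj₂ e })
                       (edge? x y ⊎-dec edge? y x)

  sum↔Vertex : (((Fin 2 × Fin k) ⊎ Fin t) ⊎ Fin 1) ↔ Vertex
  sum↔Vertex = mk↔ₛ′ to from to∘from from∘to
    where
    to : ((Fin 2 × Fin k) ⊎ Fin t) ⊎ Fin 1 → Vertex
    to (inj₁ (inj₁ (zero , i)))     = v₁ i
    to (inj₁ (inj₁ (suc zero , i))) = v′ i
    to (inj₁ (inj₂ j))              = u j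
    to (inj₂ zero)                  = v
    from : Vertex → ((Fin 2 × Fin k) ⊎ Fin t) ⊎ Fin 1
    from v      = inj₂ zero
    from (v₁ i) = inj₁ (inj₁ (zero , i))
    from (v′ i) = inj₁ (inj₁ (suc zero , i))
    from (u j)  = inj₁ (inj₂ j)
    to∘from : ∀ x → to (from x) ≡ x
    to∘from v      = refl
    to∘from (v₁ i) = refl
    to∘from (v′ i) = refl
    to∘from (u j)  = refl
    from∘to : ∀ s → from (to s) ≡ s
    from∘to (inj₁ (inj₁ (zero , i)))     = refl
    from∘to (inj₁ (inj₁ (suc zero , i))) = refl
    from∘to (inj₁ (inj₂ j))              = refl
    from∘to (inj₂ zero)                  = refl

  enumeration : Fin (2 ℕ.* k ℕ.+ t ℕ.+ 1) ↔ Vertex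
  enumeration = ↔-trans Fin.+↔⊎ (↔-trans
    (↔-trans Fin.+↔⊎ (Fin.*↔× ⊎-↔ ↔-refl) ⊎-↔ ↔-refl) sum↔Vertex)

  graph : Graph
  graph = record
    { order    = 2 ℕ.* k ℕ.+ t ℕ.+ 1
    ; Vertex   = Vertex
    ; enum     = enumeration
    ; _~_      = SymClosure Edge
    ; _~?_     = adjacent?
    ; ~-sym    = symmetric Edge
    ; ~-irrefl = λ { (fwd ()) ; (bwd ()) }
    }

Cᶜ : (k t : ℕ) → Graph
Cᶜ = FriendshipWithPendants.graph

{-# OPTIONS --safe #-}
module Submission where

-- Eigenvectors are analysed through the value a at the centre.  If a ≠ 0, summing the eigenvalue
-- equations over the triangles and over the leaves gives a · f(μ) = 0; when one of these cells is
-- empty, the same sums give a · c = 0 for the linear coefficient c of f at the spurious root, that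
-- is, the root is multiple.  If a = 0, a nonzero leaf forces μ = α, a pair of distinct values on a
-- triangle forces μ = 3α - 1, and an equal nonzero pair forces μ = α + 1; the equation at the centre
-- shows that the support can be confined to one leaf or one triangle only for α = 1, where f(α) = 0
-- and α + 1 = 3α - 1 respectively.  Conversely, with p = α - μ, q = α + 1 - μ and β = 1 - α, a root
-- μ of f has the vector (p q, -β p, -β q) on centre, triangles and leaves, which can vanish only
-- for μ = α or μ = α + 1.
open import Defs
open import Algebra.Bundles using (CommutativeRing; RawRing)
import Algebra.Properties.AbelianGroup as AbelianGroupProperties
import Algebra.Properties.Ring as RingProperties
import Algebra.Properties.Semiring.Mult as SemiringMult
import Algebra.Properties.Semiring.Sum as SemiringSum
import Algebra.Solver.Ring as RingSolver
open import Algebra.Solver.Ring.AlmostCommutativeRing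
  using (fromCommutativeRing; _-Raw-AlmostCommutative⟶_)
open import Data.Bool.Base using (true; false; if_then_else_; _∨_)
open import Data.Fin.Base using (Fin; zero; suc; fromℕ<; splitAt; remQuot; quotRem)
import Data.Fin.Properties as Fin
open import Data.Integer.Base as ℤ using (ℤ; +_; -[1+_]; _⊖_)
import Data.Integer.Properties as ℤ
open import Data.List.Base using (filter; length; tabulate)
open import Data.List.Properties using (map-tabulate)
import Data.Maybe.Base as Maybe
open import Data.Nat.Base as ℕ using (ℕ; zero; suc; s≤s; z≤n)
import Data.Nat.Properties as ℕ
open import Data.Product.Base using (_×_; _,_; swap; map₁; map₂)
import Data.Sign.Base as Sign
open import Data.Sum.Base using (_⊎_; inj₁; inj₂; [_,_]′)
open import Data.Sum.Function.Propositional using (_⊎-↔_)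
open import Function.Base using (_∘_; id; const)
open import Function.Bundles using (_⇔_; mk⇔; _↔_; Inverse)
open import Function.Properties.Inverse using (↔-refl; ↔-trans)
open import Relation.Binary.PropositionalEquality.Core as ≡ using (_≡_)
import Relation.Binary.Reasoning.Setoid as SetoidReasoning
open import Relation.Binary.Structures using (IsDecTotalOrder)
open import Relation.Nullary.Decidable using (yes; no; does; dec⇒maybe; dec-true; dec-false)
open import Relation.Nullary.Negation using (¬_; contradiction)
open import Relation.Unary using (Pred; Decidable)

-- Ring solver with integer coefficients.

-- The ring solver cancels terms only when it can decide equality of coefficients, which an
-- abstract ring does not offer; hence integer coefficients.
module IntegerCoefficients {a ℓ} (R : CommutativeRing a ℓ) where
  open CommutativeRing R
  open SemiringMult semiring using (×-homo-+; ×1-homo-*; ×-homo-1) renaming (_×_ to _×ᵣ_)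
  open RingProperties ring
  open AbelianGroupProperties +-abelianGroup using (⁻¹-∙-comm)
  open SetoidReasoning setoid

  -- The case 1 is separate so that the solver reads its constant 1 as 1# and not as 1# + 0#.
  fromℕ : ℕ → Carrier
  fromℕ 1 = 1#
  fromℕ n = n ×ᵣ 1#

  fromℤ : ℤ → Carrier
  fromℤ (+ n)    = fromℕ n
  fromℤ -[1+ n ] = - (suc n ×ᵣ 1#)

  fromℕ≈× : ∀ n → fromℕ n ≈ n ×ᵣ 1#
  fromℕ≈× 0             = refl
  fromℕ≈× 1             = sym (×-homo-1 1#)
  fromℕ≈× (suc (suc _)) = refl

  fromℤ-neg : ∀ i → fromℤ (ℤ.- i) ≈ - fromℤ i
  fromℤ-neg (+ 0)           = sym -0#≈0#
  fromℤ-neg (+ 1)           = -‿cong (+-identityʳ 1#)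
  fromℤ-neg (+ suc (suc n)) = refl
  fromℤ-neg -[1+ n ]        = trans (fromℕ≈× (suc n)) (sym (-‿involutive _))

  -- Adding integers of opposite signs computes to `_⊖_`, so this carries the mixed cases of
  -- `fromℤ-+`.
  fromℤ-⊖ : ∀ m n → fromℤ (m ⊖ n) ≈ m ×ᵣ 1# - n ×ᵣ 1#
  fromℤ-⊖ zero zero = sym (-‿inverseʳ 0#)
  fromℤ-⊖ zero (suc n) = sym (+-identityˡ _)
  fromℤ-⊖ (suc m) zero = trans (fromℕ≈× (suc m)) (sym (trans (+-congˡ -0#≈0#) (+-identityʳ _)))
  fromℤ-⊖ (suc m) (suc n) = begin
    fromℤ (suc m ⊖ suc n)   ≡⟨ ≡.cong fromℤ (ℤ.[1+m]⊖[1+n]≡m⊖n m n) ⟩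
    fromℤ (m ⊖ n)           ≈⟨ fromℤ-⊖ m n ⟩
    M - N                   ≈⟨ +-congʳ (+-identityˡ M) ⟨
    -- Inserting `1# - 1#` supplies the successors on both sides of the difference.
    0# + M - N              ≈⟨ +-congʳ (+-congʳ (-‿inverseʳ 1#)) ⟨
    1# - 1# + M - N         ≈⟨ +-congʳ (+-assoc _ _ _) ⟩
    1# + (- 1# + M) - N     ≈⟨ +-congʳ (+-congˡ (+-comm _ _)) ⟩
    1# + (M - 1#) - N       ≈⟨ +-congʳ (+-assoc _ _ _) ⟨
    1# + M - 1# - N         ≈⟨ +-assoc _ _ _ ⟩
    1# + M + (- 1# - N)     ≈⟨ +-congˡ (⁻¹-∙-comm 1# N) ⟩
    1# + M - (1# + N)       ∎
    where
    M = m ×ᵣ 1#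
    N = n ×ᵣ 1#

  fromℤ-+ : ∀ i j → fromℤ (i ℤ.+ j) ≈ fromℤ i + fromℤ j
  fromℤ-+ (+ m) (+ n) = begin
    fromℕ (m ℕ.+ n)       ≈⟨ fromℕ≈× (m ℕ.+ n) ⟩
    (m ℕ.+ n) ×ᵣ 1#       ≈⟨ ×-homo-+ 1# m n ⟩
    m ×ᵣ 1# + n ×ᵣ 1#     ≈⟨ +-cong (fromℕ≈× m) (fromℕ≈× n) ⟨
    fromℕ m + fromℕ n     ∎
  fromℤ-+ (+ m) -[1+ n ] = trans (fromℤ-⊖ m (suc n)) (+-congʳ (sym (fromℕ≈× m)))
  fromℤ-+ -[1+ m ] (+ n) = trans (fromℤ-⊖ n (suc m))
    (trans (+-congʳ (sym (fromℕ≈× n))) (+-comm _ _))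
  fromℤ-+ -[1+ m ] -[1+ n ] = begin
    - (suc (suc (m ℕ.+ n)) ×ᵣ 1#)        ≡⟨ ≡.cong (λ l → - (suc l ×ᵣ 1#)) (ℕ.+-suc m n) ⟨
    - ((suc m ℕ.+ suc n) ×ᵣ 1#)          ≈⟨ -‿cong (×-homo-+ 1# (suc m) (suc n)) ⟩
    - (suc m ×ᵣ 1# + suc n ×ᵣ 1#)        ≈⟨ ⁻¹-∙-comm _ _ ⟨
    - (suc m ×ᵣ 1#) - suc n ×ᵣ 1#        ∎

  -- An integer product is a sign applied by `◃` to the product of absolute values. As `◃` splits on
  -- zero, its value is settled first so that `×1-homo-*` can apply.
  fromℤ-+◃ : ∀ n → fromℤ (Sign.+ ℤ.◃ n) ≈ n ×ᵣ 1#
  fromℤ-+◃ zero    = refl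
  fromℤ-+◃ (suc n) = fromℕ≈× (suc n)

  fromℤ--◃ : ∀ n → fromℤ (Sign.- ℤ.◃ n) ≈ - (n ×ᵣ 1#)
  fromℤ--◃ zero    = sym -0#≈0#
  fromℤ--◃ (suc n) = refl

  fromℤ-* : ∀ i j → fromℤ (i ℤ.* j) ≈ fromℤ i * fromℤ j
  fromℤ-* (+ m) (+ n) = trans (fromℤ-+◃ (m ℕ.* n))
    (trans (×1-homo-* m n) (sym (*-cong (fromℕ≈× m) (fromℕ≈× n))))
  fromℤ-* (+ m) -[1+ n ] = begin
    fromℤ (Sign.- ℤ.◃ m ℕ.* suc n)   ≈⟨ fromℤ--◃ (m ℕ.* suc n) ⟩
    - ((m ℕ.* suc n) ×ᵣ 1#)          ≈⟨ -‿cong (×1-homo-* m (suc n)) ⟩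
    - (m ×ᵣ 1# * (suc n ×ᵣ 1#))      ≈⟨ -‿distribʳ-* _ _ ⟩
    m ×ᵣ 1# * - (suc n ×ᵣ 1#)        ≈⟨ *-congʳ (fromℕ≈× m) ⟨
    fromℕ m * - (suc n ×ᵣ 1#)        ∎
  fromℤ-* -[1+ m ] (+ n) = begin
    fromℤ (Sign.- ℤ.◃ suc m ℕ.* n)   ≈⟨ fromℤ--◃ (suc m ℕ.* n) ⟩
    - ((suc m ℕ.* n) ×ᵣ 1#)          ≈⟨ -‿cong (×1-homo-* (suc m) n) ⟩
    - (suc m ×ᵣ 1# * (n ×ᵣ 1#))      ≈⟨ -‿distribˡ-* _ _ ⟩
    - (suc m ×ᵣ 1#) * (n ×ᵣ 1#)      ≈⟨ *-congˡ (fromℕ≈× n) ⟨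
    - (suc m ×ᵣ 1#) * fromℕ n        ∎
  fromℤ-* -[1+ m ] -[1+ n ] = begin
    fromℤ (Sign.+ ℤ.◃ suc m ℕ.* suc n)     ≈⟨ fromℤ-+◃ (suc m ℕ.* suc n) ⟩
    (suc m ℕ.* suc n) ×ᵣ 1#                ≈⟨ ×1-homo-* (suc m) (suc n) ⟩
    suc m ×ᵣ 1# * (suc n ×ᵣ 1#)            ≈⟨ -‿involutive _ ⟨
    - - (suc m ×ᵣ 1# * (suc n ×ᵣ 1#))      ≈⟨ -‿cong (-‿distribˡ-* _ _) ⟩
    - (- (suc m ×ᵣ 1#) * (suc n ×ᵣ 1#))    ≈⟨ -‿distribʳ-* _ _ ⟩
    - (suc m ×ᵣ 1#) * - (suc n ×ᵣ 1#)      ∎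

  ℤ-rawRing : RawRing _ _
  ℤ-rawRing = CommutativeRing.rawRing ℤ.+-*-commutativeRing

  morphism : ℤ-rawRing -Raw-AlmostCommutative⟶ fromCommutativeRing R
  morphism = record
    { ⟦_⟧    = fromℤ
    ; +-homo = fromℤ-+
    ; *-homo = fromℤ-*
    ; -‿homo = fromℤ-neg
    ; 0-homo = refl
    ; 1-homo = refl
    }

  open RingSolver ℤ-rawRing (fromCommutativeRing R) morphism
    (λ i j → Maybe.map (reflexive ∘ ≡.cong fromℤ) (dec⇒maybe (i ℤ.≟ j))) public
    using (solve; _:=_; con; _:+_; _:*_; _:-_; :-_; _:^_)

-- Finite sums over a commutative ring.

module Summation {a ℓ} (R : CommutativeRing a ℓ) where
  open CommutativeRing R hiding (zero)
  open SemiringMult semiring using (×-assoc-*; ×-congʳ) renaming (_×_ to _×ᵣ_)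
  open SemiringSum semiring public using (sum; sum-cong-≋; sum-replicate; sum-replicate-zero;
    ∑-distrib-+; *-distribˡ-sum)
  open SetoidReasoning setoid

  sum-zero : ∀ {n} (h : Fin n → Carrier) → (∀ i → h i ≈ 0#) → sum h ≈ 0#
  sum-zero {n} h h≈0 = trans (sum-cong-≋ h≈0) (sum-replicate-zero n)

  sum-1* : ∀ {n} (h : Fin n → Carrier) → sum (λ i → 1# * h i) ≈ sum h
  sum-1* h = sum-cong-≋ (λ i → *-identityˡ (h i))

  sum-0* : ∀ {n} (h : Fin n → Carrier) → sum (λ i → 0# * h i) ≈ 0#
  sum-0* h = sum-zero _ (λ i → zeroˡ (h i))

  sum-const : ∀ {n} (h : Fin n → Carrier) {c} → (∀ i → h i ≈ c) → sum h ≈ n ×ᵣ 1# * c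
  sum-const {n} h {c} h≈c = begin
    sum h             ≈⟨ sum-cong-≋ h≈c ⟩
    sum {n} (const c) ≈⟨ sum-replicate n ⟩
    n ×ᵣ c            ≈⟨ ×-congʳ n (*-identityˡ c) ⟨
    n ×ᵣ (1# * c)     ≈⟨ ×-assoc-* n 1# c ⟨
    n ×ᵣ 1# * c       ∎

  sum-single : ∀ {n} (h : Fin n → Carrier) i → (∀ j → ¬ i ≡ j → h j ≈ 0#) → sum h ≈ h i
  sum-single h zero h≈0 =
    trans (+-congˡ (sum-zero (h ∘ suc) (λ j → h≈0 (suc j) λ ()))) (+-identityʳ _)
  sum-single h (suc i) h≈0 =
    trans (+-cong (h≈0 zero λ ())
                  (sum-single (h ∘ suc) i λ j i≢j → h≈0 (suc j) (i≢j ∘ Fin.suc-injective)))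
          (+-identityˡ _)

  sum-empty : ∀ {n} → n ≡ 0 → (h : Fin n → Carrier) → sum h ≈ 0#
  sum-empty ≡.refl h = refl

  -- The index excludes the empty sum, so one summand is left. This evaluates the sums over the
  -- leaves or the triangles when there is only one of them.
  sum-subsingleton : ∀ {n} → n ℕ.< 2 → (h : Fin n → Carrier) → ∀ i → sum h ≈ h i
  sum-subsingleton {suc zero} _ h zero = +-identityʳ _
  sum-subsingleton {suc (suc n)} (s≤s (s≤s ()))

  -- `h` lives on the disjoint union because enumerations built from `Fin.+↔⊎` compute to
  -- compositions with `splitAt`.
  sum-splitAt : ∀ m {n} (h : Fin m ⊎ Fin n → Carrier) →
                sum (h ∘ splitAt m) ≈ sum (h ∘ inj₁) + sum (h ∘ inj₂)
  sum-splitAt zero    h = sym (+-identityˡ _)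
  sum-splitAt (suc m) h = trans
    -- Past index zero, `splitAt (suc m)` is `splitAt m` with its left results shifted by `suc`; the
    -- shift is absorbed into `h`.
    (+-congˡ (sum-splitAt m (h ∘ [ inj₁ ∘ suc , inj₂ ]′)))
    (sym (+-assoc _ _ _))

-- Action of the A_α-matrix of an arbitrary graph on vectors.

module MatrixAction {ℓ} (ℝ : CompleteOrderedField ℓ) (G : Graph) where
  open CompleteOrderedField ℝ hiding (zero)
  open Spectral ℝ
  open IntegerCoefficients commutativeRing
  open Summation commutativeRing
  open Graph G
  open SetoidReasoning setoid

  private
    e : Fin order → Vertex
    e = Inverse.to enum

  length-filter-tabulate : ∀ {p} {P : Pred Vertex p} (P? : Decidable P) {n} (g : Fin n → Vertex) →
    ⟨ length (filter P? (tabulate g)) ⟩ ≈ sum (λ i → if does (P? (g i)) then 1# else 0#)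
  length-filter-tabulate P? {zero}  g = refl
  length-filter-tabulate P? {suc n} g with does (P? (g zero))
  ... | true  = +-congˡ (length-filter-tabulate P? (g ∘ suc))
  ... | false = trans (length-filter-tabulate P? (g ∘ suc)) (sym (+-identityˡ _))

  -- Counting neighbours is taking a row sum of the adjacency matrix. In this form, degrees can be
  -- read off from any formula for the adjacency action.
  degree≈ : ∀ x → ⟨ degree x ⟩ ≈ _*ᵥ_ G (adjacencyMatrix G) (const 1#) x
  degree≈ x = begin
    ⟨ degree x ⟩
      ≡⟨ ≡.cong (λ vs → ⟨ length (filter (x ~?_) vs) ⟩) (map-tabulate id e) ⟩
    ⟨ length (filter (x ~?_) (tabulate e)) ⟩
      ≈⟨ length-filter-tabulate (x ~?_) e ⟩
    sum (λ i → adjacencyMatrix G x (e i))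
      ≈⟨ sum-cong-≋ (λ i → *-identityʳ (adjacencyMatrix G x (e i))) ⟨
    sum (λ i → adjacencyMatrix G x (e i) * 1#) ∎

  degreeMatrix-*ᵥ : ∀ w x → _*ᵥ_ G (degreeMatrix G) w x ≈ ⟨ degree x ⟩ * w x
  degreeMatrix-*ᵥ w x = trans (sum-single row i₀ off) (on (e i₀) (≡.sym x≡ei₀))
    where
    i₀ = Inverse.from enum x
    row = λ i → degreeMatrix G x (e i) * w (e i)

    x≡ei₀ : e i₀ ≡ x
    x≡ei₀ = Inverse.strictlyInverseˡ enum x

    off : ∀ i → ¬ i₀ ≡ i → row i ≈ 0#
    off i i₀≢i rewrite dec-false (x ≟ e i)
      (λ x≡ei → i₀≢i (≡.trans (≡.cong (Inverse.from enum) x≡ei) (Inverse.strictlyInverseʳ enum i)))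
      = zeroˡ _

    -- `e i₀` equals `x` only propositionally; generalising it to `y` allows matching on the
    -- equation.
    on : ∀ y → x ≡ y → degreeMatrix G x y * w y ≈ ⟨ degree x ⟩ * w x
    on y ≡.refl rewrite dec-true (x ≟ x) ≡.refl = refl

  A[]-*ᵥ : ∀ α w x → _*ᵥ_ G (A[_] G α) w x
                   ≈ α * (⟨ degree x ⟩ * w x) + (1# - α) * _*ᵥ_ G (adjacencyMatrix G) w x
  A[]-*ᵥ α w x = begin
    sum (λ i → (α * D i + (1# - α) * N i) * w (e i))
      ≈⟨ sum-cong-≋ (λ i → solve 5 (λ a b c d z →
           (a :* c :+ b :* d) :* z := a :* (c :* z) :+ b :* (d :* z))
           refl α (1# - α) (D i) (N i) (w (e i))) ⟩
    sum (λ i → α * (D i * w (e i)) + (1# - α) * (N i * w (e i)))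
      ≈⟨ ∑-distrib-+ (λ i → α * (D i * w (e i))) _ ⟩
    sum (λ i → α * (D i * w (e i))) + sum (λ i → (1# - α) * (N i * w (e i)))
      ≈⟨ +-cong (*-distribˡ-sum α (λ i → D i * w (e i)))
               (*-distribˡ-sum (1# - α) (λ i → N i * w (e i))) ⟨
    α * _*ᵥ_ G (degreeMatrix G) w x + (1# - α) * _*ᵥ_ G (adjacencyMatrix G) w x
      ≈⟨ +-congʳ (*-congˡ (degreeMatrix-*ᵥ w x)) ⟩
    α * (⟨ degree x ⟩ * w x) + (1# - α) * _*ᵥ_ G (adjacencyMatrix G) w x ∎
    where
    D = λ i → degreeMatrix G x (e i)
    N = λ i → adjacencyMatrix G x (e i)

-- Action of the A_α-matrix on the graph of triangles and pendant edges.

module FriendshipMatrix {ℓ} (ℝ : CompleteOrderedField ℓ) (k t : ℕ) where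
  open CompleteOrderedField ℝ hiding (zero)
  open Spectral ℝ
  open IntegerCoefficients commutativeRing
  open Summation commutativeRing
  open FriendshipWithPendants k t
  open MatrixAction ℝ graph
  open SetoidReasoning setoid

  _*ᵍ_ : (Vertex → Vertex → Carrier) → (Vertex → Carrier) → Vertex → Carrier
  _*ᵍ_ = _*ᵥ_ graph

  -- The enumeration is a chain of bijections, undone one `sum-splitAt` at a time: first the centre
  -- is separated, then the leaves, then the two copies of `Fin k`.
  sum-Vertex : ∀ (g : Vertex → Carrier) → sum (g ∘ Inverse.to enumeration)
             ≈ sum (g ∘ v₁) + sum (g ∘ v′) + sum (g ∘ u) + g v
  sum-Vertex g = begin
    sum (g ∘ Inverse.to enumeration)
      ≈⟨ sum-splitAt (2 ℕ.* k ℕ.+ t) (h ∘ Inverse.to (split ⊎-↔ ↔-refl)) ⟩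
    sum (h ∘ inj₁ ∘ Inverse.to split) + (g v + 0#)
      ≈⟨ +-cong (sum-splitAt (2 ℕ.* k) (h ∘ inj₁ ∘ Inverse.to (pairs ⊎-↔ ↔-refl))) (+-identityʳ _) ⟩
    sum (h ∘ inj₁ ∘ inj₁ ∘ remQuot {2} k) + sum (g ∘ u) + g v
      -- `remQuot` cuts off blocks of length `k`: the `v₁`, then the `v′`, and finally an empty
      -- block, which contributes `0#`.
      ≈⟨ +-congʳ (+-congʳ (sum-splitAt k (h ∘ inj₁ ∘ inj₁ ∘ swap ∘
           [ (_, zero) , map₂ suc ∘ quotRem {1} k ]′))) ⟩
    sum (g ∘ v₁) + sum (h ∘ inj₁ ∘ inj₁ ∘ map₁ suc ∘ remQuot {1} k) + sum (g ∘ u) + g v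
      ≈⟨ +-congʳ (+-congʳ (+-congˡ (sum-splitAt k (h ∘ inj₁ ∘ inj₁ ∘ swap ∘ map₂ suc ∘
           [ (_, zero) , map₂ suc ∘ quotRem {0} k ]′)))) ⟩
    sum (g ∘ v₁) + (sum (g ∘ v′) + 0#) + sum (g ∘ u) + g v
      ≈⟨ +-congʳ (+-congʳ (+-congˡ (+-identityʳ _))) ⟩
    sum (g ∘ v₁) + sum (g ∘ v′) + sum (g ∘ u) + g v ∎
    where
    h = g ∘ Inverse.to sum↔Vertex
    pairs = Fin.*↔× {2} {k}
    split : Fin (2 ℕ.* k ℕ.+ t) ↔ ((Fin 2 × Fin k) ⊎ Fin t)
    split = ↔-trans Fin.+↔⊎ (pairs ⊎-↔ ↔-refl)

  adjacency-v : ∀ w → (adjacencyMatrix graph *ᵍ w) v ≈ sum (w ∘ v₁) + sum (w ∘ v′) + sum (w ∘ u)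
  adjacency-v w = begin
    (adjacencyMatrix graph *ᵍ w) v
      ≈⟨ sum-Vertex (λ y → adjacencyMatrix graph v y * w y) ⟩
    sum (λ i → 1# * w (v₁ i)) + sum (λ i → 1# * w (v′ i)) + sum (λ j → 1# * w (u j)) + 0# * w v
      ≈⟨ +-cong (+-cong (+-cong (sum-1* (w ∘ v₁)) (sum-1* (w ∘ v′))) (sum-1* (w ∘ u))) (zeroˡ _) ⟩
    sum (w ∘ v₁) + sum (w ∘ v′) + sum (w ∘ u) + 0#
      ≈⟨ +-identityʳ _ ⟩
    sum (w ∘ v₁) + sum (w ∘ v′) + sum (w ∘ u) ∎

  adjacency-v₁ : ∀ w i → (adjacencyMatrix graph *ᵍ w) (v₁ i) ≈ w (v′ i) + w v
  adjacency-v₁ w i = begin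
    (adjacencyMatrix graph *ᵍ w) (v₁ i)
      ≈⟨ sum-Vertex (λ y → adjacencyMatrix graph (v₁ i) y * w y) ⟩
    sum (λ j → 0# * w (v₁ j)) + sum partner + sum (λ j → 0# * w (u j)) + 1# * w v
      ≈⟨ +-cong (+-cong (+-cong (sum-0* (w ∘ v₁)) (sum-single partner i off)) (sum-0* (w ∘ u)))
                (*-identityˡ _) ⟩
    0# + partner i + 0# + w v
      ≈⟨ +-congʳ (trans (+-identityʳ _) (trans (+-identityˡ _) on)) ⟩
    w (v′ i) + w v ∎
    where
    -- `adjacent?` tests both orientations of an edge. The second one fails here, but `_∨_` computes
    -- on its first argument, so `∨ false` remains.
    partner = λ j → (if does (i Fin.≟ j) ∨ false then 1# else 0#) * w (v′ j)

    off : ∀ j → ¬ i ≡ j → partner j ≈ 0#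
    off j i≢j rewrite dec-false (i Fin.≟ j) i≢j = zeroˡ _

    on : partner i ≈ w (v′ i)
    on rewrite dec-true (i Fin.≟ i) ≡.refl = *-identityˡ _

  adjacency-v′ : ∀ w i → (adjacencyMatrix graph *ᵍ w) (v′ i) ≈ w (v₁ i) + w v
  adjacency-v′ w i = begin
    (adjacencyMatrix graph *ᵍ w) (v′ i)
      ≈⟨ sum-Vertex (λ y → adjacencyMatrix graph (v′ i) y * w y) ⟩
    sum partner + sum (λ j → 0# * w (v′ j)) + sum (λ j → 0# * w (u j)) + 1# * w v
      ≈⟨ +-cong (+-cong (+-cong (sum-single partner i off) (sum-0* (w ∘ v′))) (sum-0* (w ∘ u)))
                (*-identityˡ _) ⟩
    partner i + 0# + 0# + w v
      ≈⟨ +-congʳ (trans (+-identityʳ _) (trans (+-identityʳ _) on)) ⟩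
    w (v₁ i) + w v ∎
    where
    -- Here the first orientation fails and the disjunction reduces to the second, which compares
    -- `j` with `i` in this order.
    partner = λ j → (if does (j Fin.≟ i) then 1# else 0#) * w (v₁ j)

    off : ∀ j → ¬ i ≡ j → partner j ≈ 0#
    off j i≢j rewrite dec-false (j Fin.≟ i) (i≢j ∘ ≡.sym) = zeroˡ _

    on : partner i ≈ w (v₁ i)
    on rewrite dec-true (i Fin.≟ i) ≡.refl = *-identityˡ _

  adjacency-u : ∀ w j → (adjacencyMatrix graph *ᵍ w) (u j) ≈ w v
  adjacency-u w j = begin
    (adjacencyMatrix graph *ᵍ w) (u j)
      ≈⟨ sum-Vertex (λ y → adjacencyMatrix graph (u j) y * w y) ⟩
    sum (λ i → 0# * w (v₁ i)) + sum (λ i → 0# * w (v′ i)) + sum (λ i → 0# * w (u i)) + 1# * w v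
      ≈⟨ +-cong (+-cong (+-cong (sum-0* (w ∘ v₁)) (sum-0* (w ∘ v′))) (sum-0* (w ∘ u)))
                (*-identityˡ _) ⟩
    0# + 0# + 0# + w v
      ≈⟨ solve 1 (λ a → con (+ 0) :+ con (+ 0) :+ con (+ 0) :+ a := a) refl (w v) ⟩
    w v ∎

  private
    degree : Vertex → ℕ
    degree = Graph.degree graph

    1s : Vertex → Carrier
    1s = const 1#

  -- Here and for the other vertices, the degree is the adjacency action on the all-ones vector.
  degree-v : ⟨ degree v ⟩ ≈ ⟨ 2 ⟩ * ⟨ k ⟩ + ⟨ t ⟩
  degree-v = begin
    ⟨ degree v ⟩
      ≈⟨ trans (degree≈ v) (adjacency-v 1s) ⟩
    sum (1s ∘ v₁) + sum (1s ∘ v′) + sum (1s ∘ u)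
      ≈⟨ +-cong (+-cong (sum-const (1s ∘ v₁) (λ _ → refl)) (sum-const (1s ∘ v′) (λ _ → refl)))
                (sum-const (1s ∘ u) (λ _ → refl)) ⟩
    ⟨ k ⟩ * 1# + ⟨ k ⟩ * 1# + ⟨ t ⟩ * 1#
      ≈⟨ solve 2 (λ K T → K :* con (+ 1) :+ K :* con (+ 1) :+ T :* con (+ 1)
                       := con (+ 2) :* K :+ T) refl ⟨ k ⟩ ⟨ t ⟩ ⟩
    ⟨ 2 ⟩ * ⟨ k ⟩ + ⟨ t ⟩ ∎

  degree-v₁ : ∀ i → ⟨ degree (v₁ i) ⟩ ≈ 1# + 1#
  degree-v₁ i = trans (degree≈ (v₁ i)) (adjacency-v₁ 1s i)

  degree-v′ : ∀ i → ⟨ degree (v′ i) ⟩ ≈ 1# + 1#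
  degree-v′ i = trans (degree≈ (v′ i)) (adjacency-v′ 1s i)

  degree-u : ∀ j → ⟨ degree (u j) ⟩ ≈ 1#
  degree-u j = trans (degree≈ (u j)) (adjacency-u 1s j)

  module _ (α : Carrier) (w : Vertex → Carrier) where

    A-v : (A[_] graph α *ᵍ w) v ≈ α * ((⟨ 2 ⟩ * ⟨ k ⟩ + ⟨ t ⟩) * w v)
        + (1# - α) * (sum (w ∘ v₁) + sum (w ∘ v′) + sum (w ∘ u))
    A-v = trans (A[]-*ᵥ α w v)
      (+-cong (*-congˡ (*-congʳ degree-v)) (*-congˡ (adjacency-v w)))

    A-v₁ : ∀ i → (A[_] graph α *ᵍ w) (v₁ i)
         ≈ α * ((1# + 1#) * w (v₁ i)) + (1# - α) * (w (v′ i) + w v)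
    A-v₁ i = trans (A[]-*ᵥ α w (v₁ i))
      (+-cong (*-congˡ (*-congʳ (degree-v₁ i))) (*-congˡ (adjacency-v₁ w i)))

    A-v′ : ∀ i → (A[_] graph α *ᵍ w) (v′ i)
         ≈ α * ((1# + 1#) * w (v′ i)) + (1# - α) * (w (v₁ i) + w v)
    A-v′ i = trans (A[]-*ᵥ α w (v′ i))
      (+-cong (*-congˡ (*-congʳ (degree-v′ i))) (*-congˡ (adjacency-v′ w i)))

    A-u : ∀ j → (A[_] graph α *ᵍ w) (u j) ≈ α * (1# * w (u j)) + (1# - α) * w v
    A-u j = trans (A[]-*ᵥ α w (u j))
      (+-cong (*-congˡ (*-congʳ (degree-u j))) (*-congˡ (adjacency-u w j)))

-- Consequences of the ordered field axioms.

module OrderedField {ℓ} (ℝ : CompleteOrderedField ℓ) where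
  open CompleteOrderedField ℝ hiding (zero)
  open Spectral ℝ
  open IntegerCoefficients commutativeRing
  open AbelianGroupProperties +-abelianGroup public
    using () renaming (x∙y⁻¹≈ε⇒x≈y to x-y≈0⇒x≈y; x≈y⇒x∙y⁻¹≈ε to x≈y⇒x-y≈0)
  open IsDecTotalOrder isDecTotalOrder public
    using (total; antisym; ≤-respˡ-≈; ≤-respʳ-≈)
    renaming (_≟_ to _≈?_; refl to ≤-refl; trans to ≤-trans)
  open SetoidReasoning setoid

  x≈0⇒y*x≈0 : ∀ y {x} → x ≈ 0# → y * x ≈ 0#
  x≈0⇒y*x≈0 y x≈0 = trans (*-congˡ x≈0) (zeroʳ y)

  x,y≈0⇒x+y≈0 : ∀ {x y} → x ≈ 0# → y ≈ 0# → x + y ≈ 0#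
  x,y≈0⇒x+y≈0 x≈0 y≈0 = trans (+-cong x≈0 y≈0) (+-identityˡ 0#)

  x*y≈0⇒y≈0 : ∀ {x y} → ¬ x ≈ 0# → x * y ≈ 0# → y ≈ 0#
  x*y≈0⇒y≈0 {x} {y} x≉0 xy≈0 = let x⁻¹ , xx⁻¹≈1 = inverse x x≉0 in begin
    y                ≈⟨ *-identityˡ y ⟨
    1# * y           ≈⟨ *-congʳ xx⁻¹≈1 ⟨
    x * x⁻¹ * y      ≈⟨ solve 3 (λ x x⁻¹ y → x :* x⁻¹ :* y := x⁻¹ :* (x :* y)) refl x x⁻¹ y ⟩
    x⁻¹ * (x * y)    ≈⟨ x≈0⇒y*x≈0 x⁻¹ xy≈0 ⟩
    0#               ∎

  x*x≈0⇒x≈0 : ∀ {x} → x * x ≈ 0# → x ≈ 0#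
  x*x≈0⇒x≈0 {x} xx≈0 with x ≈? 0#
  ... | yes x≈0 = x≈0
  ... | no  x≉0 = x*y≈0⇒y≈0 x≉0 xx≈0

  -- If 1 ≤ 0, then -1 is nonnegative, and hence so is its square 1.
  0≤1 : 0# ≤ 1#
  0≤1 with total 0# 1#
  ... | inj₁ 0≤1 = 0≤1
  ... | inj₂ 1≤0 = ≤-respʳ-≈ (solve 0 (:- con (+ 1) :* :- con (+ 1) := con (+ 1)) refl)
                             (*-nonNegative 0≤-1 0≤-1)
    where
    0≤-1 : 0# ≤ - 1#
    0≤-1 = ≤-respˡ-≈ (-‿inverseʳ 1#) (≤-respʳ-≈ (+-identityˡ (- 1#)) (+-monoˡ-≤ (- 1#) 1≤0))

  1≤⟨1+n⟩ : ∀ n → 1# ≤ ⟨ suc n ⟩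
  0≤⟨n⟩ : ∀ n → 0# ≤ ⟨ n ⟩
  0≤⟨n⟩ zero    = ≤-refl
  0≤⟨n⟩ (suc n) = ≤-trans 0≤1 (1≤⟨1+n⟩ n)
  1≤⟨1+n⟩ n = ≤-respˡ-≈ (+-identityˡ 1#) (≤-respʳ-≈ (+-comm ⟨ n ⟩ 1#) (+-monoˡ-≤ 1# (0≤⟨n⟩ n)))

  -- Characteristic zero, which permits cancelling `⟨ k ⟩`, `⟨ t ⟩` and the constants 2 and 6.
  ⟨1+n⟩≉0 : ∀ n → ¬ ⟨ suc n ⟩ ≈ 0#
  ⟨1+n⟩≉0 n 1+n≈0 = 0≉1 (antisym 0≤1 (≤-respʳ-≈ 1+n≈0 (1≤⟨1+n⟩ n)))

  x≉x+1 : ∀ x → ¬ x ≈ x + 1#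
  x≉x+1 x x≈x+1 = 0≉1 (begin
    0#            ≈⟨ -‿inverseˡ x ⟨
    - x + x       ≈⟨ +-congˡ x≈x+1 ⟩
    - x + (x + 1#) ≈⟨ solve 1 (λ x → :- x :+ (x :+ con (+ 1)) := con (+ 1)) refl x ⟩
    1#            ∎)

  n≢0⇒⟨n⟩≉0 : ∀ {n} → ¬ n ≡ 0 → ¬ ⟨ n ⟩ ≈ 0#
  n≢0⇒⟨n⟩≉0 {zero}  0≢0 = contradiction ≡.refl 0≢0
  n≢0⇒⟨n⟩≉0 {suc n} _   = ⟨1+n⟩≉0 n

  n≡0⇒⟨n⟩≈0 : ∀ {n} → n ≡ 0 → ⟨ n ⟩ ≈ 0#
  n≡0⇒⟨n⟩≈0 = reflexive ∘ ≡.cong ⟨_⟩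

  -- The two values differ by 2(1 - α). This accounts for the eigenvalue α + 1 when it occurs with a
  -- single triangle.
  α+1≈3α-1 : ∀ {α} → 1# - α ≈ 0# → α + 1# ≈ ⟨ 3 ⟩ * α - 1#
  α+1≈3α-1 {α} β≈0 = begin
    α + 1#
      ≈⟨ solve 1 (λ α → α :+ con (+ 1)
           := con (+ 3) :* α :- con (+ 1) :+ con (+ 2) :* (con (+ 1) :- α)) refl α ⟩
    ⟨ 3 ⟩ * α - 1# + ⟨ 2 ⟩ * (1# - α) ≈⟨ +-congˡ (x≈0⇒y*x≈0 _ β≈0) ⟩
    ⟨ 3 ⟩ * α - 1# + 0#               ≈⟨ +-identityʳ _ ⟩
    ⟨ 3 ⟩ * α - 1#                    ∎

-- The cubic f and its expansions at α and α + 1.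

module CharacteristicPolynomial {ℓ} (ℝ : CompleteOrderedField ℓ) where
  open CompleteOrderedField ℝ hiding (zero)
  open Spectral ℝ
  open IntegerCoefficients commutativeRing
  open OrderedField ℝ
  open SemiringMult semiring using (×-homo-+; ×1-homo-*)
  open SetoidReasoning setoid

  ⟨n⟩≈ : ∀ k t → ⟨ 2 ℕ.* k ℕ.+ t ℕ.+ 1 ⟩ ≈ ⟨ 2 ⟩ * ⟨ k ⟩ + ⟨ t ⟩ + 1#
  ⟨n⟩≈ k t = trans (×-homo-+ 1# (2 ℕ.* k ℕ.+ t) 1)
    (+-cong (trans (×-homo-+ 1# (2 ℕ.* k) t) (+-congʳ (×1-homo-* 2 k))) (+-identityʳ 1#))

  -- The determinant of B - μ, expanded along the centre row, where B is the quotient matrix with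
  -- rows (α(2K + T), 2Kβ, Tβ), (β, α + 1, 0) and (β, 0, α) for centre, triangles and leaves, and β
  -- = 1 - α.
  χ : (K T α μ : Carrier) → Carrier
  χ K T α μ = (α * (⟨ 2 ⟩ * K + T) - μ) * (α + 1# - μ) * (α - μ)
            - ⟨ 2 ⟩ * K * ((1# - α) * (1# - α)) * (α - μ)
            - T * ((1# - α) * (1# - α)) * (α + 1# - μ)

  f≈χ : ∀ k t α μ → f (2 ℕ.* k ℕ.+ t ℕ.+ 1) t α μ ≈ χ ⟨ k ⟩ ⟨ t ⟩ α μ
  f≈χ k t α μ = begin
    f n t α μ
      -- The solver treats `⟨ n ⟩` as a free variable, so the identity carries a correction term, a
      -- multiple of n - (2k + t + 1), which the next step removes.
      ≈⟨ solve 5 (λ N K T α μ → let y = α :- μ ; β = con (+ 1) :- α in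
           y :^ 3 :+ (N :* α :- con (+ 2) :* α :+ con (+ 1)) :* y :^ 2
           :+ ((con (+ 1) :- N) :* α :^ 2 :+ (con (+ 3) :* N :- con (+ 4)) :* α :+ con (+ 1) :- N) :* y
           :- T :* β :^ 2
           := (α :* (con (+ 2) :* K :+ T) :- μ) :* (α :+ con (+ 1) :- μ) :* (α :- μ)
              :- con (+ 2) :* K :* (β :* β) :* (α :- μ)
              :- T :* (β :* β) :* (α :+ con (+ 1) :- μ)
              :+ (α :* y :* y :+ (con (+ 3) :* α :- α :* α :- con (+ 1)) :* y)
                 :* (N :- (con (+ 2) :* K :+ T :+ con (+ 1))))
           refl ⟨ n ⟩ ⟨ k ⟩ ⟨ t ⟩ α μ ⟩
    χ ⟨ k ⟩ ⟨ t ⟩ α μ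
    + (α * (α - μ) * (α - μ) + (⟨ 3 ⟩ * α - α * α - 1#) * (α - μ))
      * (⟨ n ⟩ - (⟨ 2 ⟩ * ⟨ k ⟩ + ⟨ t ⟩ + 1#))
      ≈⟨ trans (+-congˡ (x≈0⇒y*x≈0 _ (x≈y⇒x-y≈0 (⟨n⟩≈ k t)))) (+-identityʳ _) ⟩
    χ ⟨ k ⟩ ⟨ t ⟩ α μ ∎
    where
    n = 2 ℕ.* k ℕ.+ t ℕ.+ 1

  -- Division by α - μ, using α + 1 - μ = 1 + (α - μ). The remainder shows that, in the presence of
  -- leaves, α is a root only if 1 - α vanishes.
  χ-near-α : ∀ K T α μ → χ K T α μ
    ≈ ((α * (⟨ 2 ⟩ * K + T) - μ) * (α + 1# - μ) - (⟨ 2 ⟩ * K + T) * ((1# - α) * (1# - α))) * (α - μ)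
      - T * ((1# - α) * (1# - α))
  χ-near-α = solve 4 (λ K T α μ → let β² = (con (+ 1) :- α) :* (con (+ 1) :- α) in
    (α :* (con (+ 2) :* K :+ T) :- μ) :* (α :+ con (+ 1) :- μ) :* (α :- μ)
    :- con (+ 2) :* K :* β² :* (α :- μ) :- T :* β² :* (α :+ con (+ 1) :- μ)
    := ((α :* (con (+ 2) :* K :+ T) :- μ) :* (α :+ con (+ 1) :- μ)
        :- (con (+ 2) :* K :+ T) :* β²) :* (α :- μ) :- T :* β²) refl

  -- The same division by α + 1 - μ; the remainder now ties the root α + 1 to the triangles.
  χ-near-α+1 : ∀ K T α μ → χ K T α μ
    ≈ ((α * (⟨ 2 ⟩ * K + T) - μ) * (α - μ) - (⟨ 2 ⟩ * K + T) * ((1# - α) * (1# - α))) * (α + 1# - μ)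
      + ⟨ 2 ⟩ * (K * ((1# - α) * (1# - α)))
  χ-near-α+1 = solve 4 (λ K T α μ → let β² = (con (+ 1) :- α) :* (con (+ 1) :- α) in
    (α :* (con (+ 2) :* K :+ T) :- μ) :* (α :+ con (+ 1) :- μ) :* (α :- μ)
    :- con (+ 2) :* K :* β² :* (α :- μ) :- T :* β² :* (α :+ con (+ 1) :- μ)
    := ((α :* (con (+ 2) :* K :+ T) :- μ) :* (α :- μ)
        :- (con (+ 2) :* K :+ T) :* β²) :* (α :+ con (+ 1) :- μ) :+ con (+ 2) :* (K :* β²)) refl

  IsMultipleRoot-resp-≈ : ∀ {g μ ν} → μ ≈ ν → IsMultipleRoot g μ → IsMultipleRoot g ν
  IsMultipleRoot-resp-≈ μ≈ν (a , b , g≈) = a , b , λ x →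
    let x-μ≈x-ν = +-congˡ (-‿cong μ≈ν) in
    trans (g≈ x) (*-congʳ (*-cong x-μ≈x-ν (*-congʳ x-μ≈x-ν)))

  -- The hypothesis expands a cubic with leading coefficient -1 and root `p` in powers of x - p. Its
  -- linear coefficient is `c`, so `p` is a multiple root exactly when `c` vanishes.
  module _ {g : Carrier → Carrier} (p e c : Carrier)
           (g≈ : ∀ x → g x ≈ (x - p) * (c + e * (x - p) - (x - p) * (x - p))) where

    c≈0⇒multiple : c ≈ 0# → IsMultipleRoot g p
    c≈0⇒multiple c≈0 = - 1# , p + e , λ x → begin
      g x ≈⟨ g≈ x ⟩
      (x - p) * (c + e * (x - p) - (x - p) * (x - p))
        ≈⟨ solve 4 (λ x p e c → (x :- p) :* (c :+ e :* (x :- p) :- (x :- p) :* (x :- p))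
             := (x :- p) :^ 2 :* (:- con (+ 1) :* x :+ (p :+ e)) :+ (x :- p) :* c) refl x p e c ⟩
      (x - p) ^ 2 * (- 1# * x + (p + e)) + (x - p) * c
        ≈⟨ trans (+-congˡ (x≈0⇒y*x≈0 _ c≈0)) (+-identityʳ _) ⟩
      (x - p) ^ 2 * (- 1# * x + (p + e)) ∎

    -- Comparing the two forms of g at p + 2, p + 1 and p - 1 with weights 1, -6 and 2 kills
    -- the quadratic and cubic coefficients and leaves -6 c.
    multiple⇒c≈0 : IsMultipleRoot g p → c ≈ 0#
    multiple⇒c≈0 (a , b , g≈′) = x*y≈0⇒y≈0 (⟨1+n⟩≉0 5) (begin
      ⟨ 6 ⟩ * c
        ≈⟨ solve 5 (λ p e c a b →
             let D = λ x → (x :- p) :* (c :+ e :* (x :- p) :- (x :- p) :* (x :- p))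
                           :- (x :- p) :^ 2 :* (a :* x :+ b)
             in con (+ 6) :* c
                := :- con (+ 1) :* D (p :+ con (+ 2)) :+ con (+ 6) :* D (p :+ con (+ 1))
                   :+ :- con (+ 2) :* D (p :- con (+ 1))) refl p e c a b ⟩
      - 1# * D (p + ⟨ 2 ⟩) + ⟨ 6 ⟩ * D (p + 1#) + - ⟨ 2 ⟩ * D (p - 1#)
        ≈⟨ x,y≈0⇒x+y≈0 (x,y≈0⇒x+y≈0 (x≈0⇒y*x≈0 _ (D≈0 _)) (x≈0⇒y*x≈0 _ (D≈0 _)))
                       (x≈0⇒y*x≈0 _ (D≈0 _)) ⟩
      0# ∎)
      where
      D : Carrier → Carrier
      D x = (x - p) * (c + e * (x - p) - (x - p) * (x - p)) - (x - p) ^ 2 * (a * x + b)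

      D≈0 : ∀ x → D x ≈ 0#
      D≈0 x = x≈y⇒x-y≈0 (trans (sym (g≈ x)) (g≈′ x))

  module _ (k t : ℕ) (α : Carrier) where
    private
      K T β² : Carrier
      K  = ⟨ k ⟩
      T  = ⟨ t ⟩
      β² = (1# - α) * (1# - α)

      g : Carrier → Carrier
      g = f (2 ℕ.* k ℕ.+ t ℕ.+ 1) t α

    -- When a cell is empty, f is a linear factor times a quadratic. These are the values of the
    -- quadratic at the spurious root: α for t = 0 and α + 1 for k = 0.
    cofactor-α cofactor-α+1 : Carrier
    cofactor-α   = ⟨ 2 ⟩ * K * β² + α - ⟨ 2 ⟩ * K * α
    cofactor-α+1 = T * β² + α * T - α - 1#

    -- Without leaves χ is divisible by α - x. For free T the identity leaves a multiple of T, which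
    -- vanishes; `f-at-α+1` does the same with K.
    f-at-α : T ≈ 0# → ∀ x → g x ≈ (x - α) *
      (cofactor-α + (1# + ⟨ 2 ⟩ * K * α - α) * (x - α) - (x - α) * (x - α))
    f-at-α T≈0 x = begin
      g x       ≈⟨ f≈χ k t α x ⟩
      χ K T α x ≈⟨ solve 4 (λ K T α x → let β² = (con (+ 1) :- α) :* (con (+ 1) :- α) in
        (α :* (con (+ 2) :* K :+ T) :- x) :* (α :+ con (+ 1) :- x) :* (α :- x)
        :- con (+ 2) :* K :* β² :* (α :- x) :- T :* β² :* (α :+ con (+ 1) :- x)
        := (x :- α) :* (con (+ 2) :* K :* β² :+ α :- con (+ 2) :* K :* α
             :+ (con (+ 1) :+ con (+ 2) :* K :* α :- α) :* (x :- α) :- (x :- α) :* (x :- α))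
           :+ (α :* (α :+ con (+ 1) :- x) :* (α :- x) :- β² :* (α :+ con (+ 1) :- x)) :* T)
        refl K T α x ⟩
      (x - α) * (cofactor-α + (1# + ⟨ 2 ⟩ * K * α - α) * (x - α) - (x - α) * (x - α))
      + (α * (α + 1# - x) * (α - x) - β² * (α + 1# - x)) * T
        ≈⟨ trans (+-congˡ (x≈0⇒y*x≈0 _ T≈0)) (+-identityʳ _) ⟩
      _ ∎

    f-at-α+1 : K ≈ 0# → ∀ x → g x ≈ (x - (α + 1#)) *
      (cofactor-α+1 + (α * T - α - ⟨ 2 ⟩) * (x - (α + 1#)) - (x - (α + 1#)) * (x - (α + 1#)))
    f-at-α+1 K≈0 x = begin
      g x       ≈⟨ f≈χ k t α x ⟩
      χ K T α x ≈⟨ solve 4 (λ K T α x → let β² = (con (+ 1) :- α) :* (con (+ 1) :- α)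
                                            h = x :- (α :+ con (+ 1)) in
        (α :* (con (+ 2) :* K :+ T) :- x) :* (α :+ con (+ 1) :- x) :* (α :- x)
        :- con (+ 2) :* K :* β² :* (α :- x) :- T :* β² :* (α :+ con (+ 1) :- x)
        := h :* (T :* β² :+ α :* T :- α :- con (+ 1)
             :+ (α :* T :- α :- con (+ 2)) :* h :- h :* h)
           :+ (con (+ 2) :* α :* (α :+ con (+ 1) :- x) :* (α :- x) :- con (+ 2) :* β² :* (α :- x)) :* K)
        refl K T α x ⟩
      (x - (α + 1#)) *
      (cofactor-α+1 + (α * T - α - ⟨ 2 ⟩) * (x - (α + 1#)) - (x - (α + 1#)) * (x - (α + 1#)))
      + (⟨ 2 ⟩ * α * (α + 1# - x) * (α - x) - ⟨ 2 ⟩ * β² * (α - x)) * K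
        ≈⟨ trans (+-congˡ (x≈0⇒y*x≈0 _ K≈0)) (+-identityʳ _) ⟩
      _ ∎

-- From the listed values to eigenvectors.

module EigenvalueConstruction {ℓ} (ℝ : CompleteOrderedField ℓ) (k t : ℕ)
  (α μ : CompleteOrderedField.Carrier ℝ) where
  open CompleteOrderedField ℝ hiding (zero)
  open Spectral ℝ
  open IntegerCoefficients commutativeRing
  open Summation commutativeRing
  open OrderedField ℝ
  open CharacteristicPolynomial ℝ
  open FriendshipWithPendants k t
  open FriendshipMatrix ℝ k t
  open SetoidReasoning setoid

  private
    K T β : Carrier
    K = ⟨ k ⟩
    T = ⟨ t ⟩
    β = 1# - α

  Eigenvalue : Set ℓ
  Eigenvalue = IsEigenvalue graph (A[_] graph α) μ

  vector : Carrier → (Fin k → Carrier) → (Fin k → Carrier) → (Fin t → Carrier) → Vertex → Carrier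
  vector a x y z v      = a
  vector a x y z (v₁ i) = x i
  vector a x y z (v′ i) = y i
  vector a x y z (u j)  = z j

  eigenvalue : ∀ a x y z → ¬ (∀ i → vector a x y z i ≈ 0#) →
    α * ((⟨ 2 ⟩ * K + T) * a) + β * (sum x + sum y + sum z) ≈ μ * a →
    (∀ i → α * ((1# + 1#) * x i) + β * (y i + a) ≈ μ * x i) →
    (∀ i → α * ((1# + 1#) * y i) + β * (x i + a) ≈ μ * y i) →
    (∀ j → α * (1# * z j) + β * a ≈ μ * z j) →
    Eigenvalue
  eigenvalue a x y z w≉0 at-v at-v₁ at-v′ at-u = w , w≉0 , λ where
      v      → trans (A-v α w) at-v
      (v₁ i) → trans (A-v₁ α w i) (at-v₁ i)
      (v′ i) → trans (A-v′ α w i) (at-v′ i)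
      (u j)  → trans (A-u α w j) (at-u j)
    where
    w = vector a x y z

  -- `b` and `b′` are separate to admit vectors antisymmetric on each triangle. The leaf equation
  -- takes an element of `Fin t`, so it is vacuous when there are no leaves.
  eigenvalue-of-quotient : ∀ a b b′ c → ¬ (∀ i → vector a (const b) (const b′) (const c) i ≈ 0#) →
    α * ((⟨ 2 ⟩ * K + T) * a) + β * (K * b + K * b′ + T * c) ≈ μ * a →
    α * ((1# + 1#) * b) + β * (b′ + a) ≈ μ * b →
    α * ((1# + 1#) * b′) + β * (b + a) ≈ μ * b′ →
    (Fin t → α * (1# * c) + β * a ≈ μ * c) →
    Eigenvalue
  eigenvalue-of-quotient a b b′ c w≉0 at-v at-v₁ at-v′ at-u =
    eigenvalue a (const b) (const b′) (const c) w≉0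
      (trans (+-congˡ (*-congˡ (+-cong (+-cong (sum-const {k} _ (λ _ → refl))
                                              (sum-const {k} _ (λ _ → refl)))
                                       (sum-const {t} _ (λ _ → refl)))))
             at-v)
      (λ _ → at-v₁) (λ _ → at-v′) at-u

  -- The entries cancel in the sum, so a vector built from a dipole with zero at the centre
  -- satisfies the centre equation.
  dipole : ∀ {n} → Fin n → Carrier
  dipole zero          = 1#
  dipole (suc zero)    = - 1#
  dipole (suc (suc _)) = 0#

  sum-dipole : ∀ {n} → 2 ℕ.≤ n → sum {n} dipole ≈ 0#
  sum-dipole {suc (suc n)} (s≤s (s≤s _)) = begin
    1# + (- 1# + sum {n} (const 0#)) ≈⟨ +-congˡ (+-congˡ (sum-zero {n} _ (λ _ → refl))) ⟩
    1# + (- 1# + 0#)                 ≈⟨ solve 0 (con (+ 1) :+ (:- con (+ 1) :+ con (+ 0))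
                                                 := con (+ 0)) refl ⟩
    0# ∎

  dipole≉0 : ∀ {n} → 2 ℕ.≤ n → ¬ (∀ i → dipole {n} i ≈ 0#)
  dipole≉0 {suc n} _ d≈0 = 0≉1 (sym (d≈0 zero))

  -- A dipole on two leaves: with zero at the centre, the matrix multiplies each leaf entry by α.
  eigenvalue-α : 2 ℕ.≤ t → μ ≈ α → Eigenvalue
  eigenvalue-α 2≤t μ≈α = eigenvalue 0# (const 0#) (const 0#) dipole
    (λ w≈0 → dipole≉0 2≤t (w≈0 ∘ u))
    (begin
      α * ((⟨ 2 ⟩ * K + T) * 0#) + β * (sum {k} (const 0#) + sum {k} (const 0#) + sum {t} dipole)
        ≈⟨ +-congˡ (*-congˡ (+-cong (+-cong 0s 0s) (sum-dipole 2≤t))) ⟩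
      α * ((⟨ 2 ⟩ * K + T) * 0#) + β * (0# + 0# + 0#)
        ≈⟨ solve 4 (λ α β d μ → let O = con (+ 0) in α :* (d :* O) :+ β :* (O :+ O :+ O) := μ :* O)
             refl α β (⟨ 2 ⟩ * K + T) μ ⟩
      μ * 0# ∎)
    (λ _ → zeros) (λ _ → zeros)
    (λ j → trans (solve 3 (λ α β z → α :* (con (+ 1) :* z) :+ β :* con (+ 0) := α :* z) refl α β (dipole j))
                 (*-congʳ (sym μ≈α)))
    where
    0s = sum-zero {k} (const 0#) (λ _ → refl)
    zeros = solve 3 (λ α β μ → let O = con (+ 0) in α :* ((con (+ 1) :+ con (+ 1)) :* O) :+ β :* (O :+ O) := μ :* O)
              refl α β μ

  -- A dipole on two triangles, equal on the two outer vertices of each: the factor is 2α + (1 - α)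
  -- = α + 1.
  eigenvalue-α+1 : 2 ℕ.≤ k → μ ≈ α + 1# → Eigenvalue
  eigenvalue-α+1 2≤k μ≈α+1 = eigenvalue 0# dipole dipole (const 0#)
    (λ w≈0 → dipole≉0 2≤k (w≈0 ∘ v₁))
    (begin
      α * ((⟨ 2 ⟩ * K + T) * 0#) + β * (sum {k} dipole + sum {k} dipole + sum {t} (const 0#))
        ≈⟨ +-congˡ (*-congˡ (+-cong (+-cong (sum-dipole 2≤k) (sum-dipole 2≤k))
                                    (sum-zero {t} _ (λ _ → refl)))) ⟩
      α * ((⟨ 2 ⟩ * K + T) * 0#) + β * (0# + 0# + 0#)
        ≈⟨ solve 4 (λ α β d μ → let O = con (+ 0) in α :* (d :* O) :+ β :* (O :+ O :+ O) := μ :* O)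
             refl α β (⟨ 2 ⟩ * K + T) μ ⟩
      μ * 0# ∎)
    at-triangle at-triangle
    (λ _ → solve 3 (λ α β μ → let O = con (+ 0) in α :* (con (+ 1) :* O) :+ β :* O := μ :* O) refl α β μ)
    where
    at-triangle : ∀ i → α * ((1# + 1#) * dipole i) + β * (dipole i + 0#) ≈ μ * dipole i
    at-triangle i = trans
      (solve 2 (λ α x → α :* ((con (+ 1) :+ con (+ 1)) :* x) :+ (con (+ 1) :- α) :* (x :+ con (+ 0))
                := (α :+ con (+ 1)) :* x) refl α (dipole i))
      (*-congʳ (sym μ≈α+1))

  -- Opposite values on the two outer vertices cancel at the centre within each triangle, so one
  -- triangle suffices; the factor is 2α - (1 - α).
  eigenvalue-3α-1 : 1 ℕ.≤ k → μ ≈ ⟨ 3 ⟩ * α - 1# → Eigenvalue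
  eigenvalue-3α-1 1≤k μ≈3α-1 = eigenvalue-of-quotient 0# 1# (- 1#) 0#
    (λ w≈0 → 0≉1 (sym (w≈0 (v₁ (fromℕ< 1≤k)))))
    (solve 5 (λ α β K T μ → let O = con (+ 0); I = con (+ 1) in
       α :* ((con (+ 2) :* K :+ T) :* O) :+ β :* (K :* I :+ K :* :- I :+ T :* O) := μ :* O)
       refl α β K T μ)
    (trans (solve 1 (λ α → let I = con (+ 1) in
              α :* ((I :+ I) :* I) :+ (I :- α) :* (:- I :+ con (+ 0)) := (con (+ 3) :* α :- I) :* I)
              refl α)
           (*-congʳ (sym μ≈3α-1)))
    (trans (solve 1 (λ α → let I = con (+ 1) in
              α :* ((I :+ I) :* :- I) :+ (I :- α) :* (I :+ con (+ 0)) := (con (+ 3) :* α :- I) :* :- I)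
              refl α)
           (*-congʳ (sym μ≈3α-1)))
    (λ _ → solve 3 (λ α β μ → let O = con (+ 0) in α :* (con (+ 1) :* O) :+ β :* O := μ :* O) refl α β μ)

  private
    n : ℕ
    n = 2 ℕ.* k ℕ.+ t ℕ.+ 1

    α-μ≈0 : μ ≈ α → α - μ ≈ 0#
    α-μ≈0 μ≈α = x≈y⇒x-y≈0 (sym μ≈α)

    α+1-μ≈0 : μ ≈ α + 1# → α + 1# - μ ≈ 0#
    α+1-μ≈0 μ≈α+1 = x≈y⇒x-y≈0 (sym μ≈α+1)

  leaves⇒β≈0 : ¬ t ≡ 0 → μ ≈ α → χ K T α μ ≈ 0# → β ≈ 0#
  leaves⇒β≈0 t≢0 μ≈α χ≈0 = x*x≈0⇒x≈0 (x*y≈0⇒y≈0 (n≢0⇒⟨n⟩≉0 t≢0) (sym (x-y≈0⇒x≈y _ _ (begin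
    0# - T * (β * β)        ≈⟨ +-congʳ (x≈0⇒y*x≈0 _ (α-μ≈0 μ≈α)) ⟨
    _ * (α - μ) - T * (β * β) ≈⟨ χ-near-α K T α μ ⟨
    χ K T α μ               ≈⟨ χ≈0 ⟩
    0#                      ∎))))

  triangles⇒β≈0 : ¬ k ≡ 0 → μ ≈ α + 1# → χ K T α μ ≈ 0# → β ≈ 0#
  triangles⇒β≈0 k≢0 μ≈α+1 χ≈0 =
    x*x≈0⇒x≈0 (x*y≈0⇒y≈0 (n≢0⇒⟨n⟩≉0 k≢0) (x*y≈0⇒y≈0 (⟨1+n⟩≉0 1) (begin
      ⟨ 2 ⟩ * (K * (β * β))                       ≈⟨ +-identityˡ _ ⟨
      0# + ⟨ 2 ⟩ * (K * (β * β))                  ≈⟨ +-congʳ (x≈0⇒y*x≈0 _ (α+1-μ≈0 μ≈α+1)) ⟨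
      _ * (α + 1# - μ) + ⟨ 2 ⟩ * (K * (β * β))    ≈⟨ χ-near-α+1 K T α μ ⟨
      χ K T α μ                                   ≈⟨ χ≈0 ⟩
      0#                                          ∎)))

  -- The vector is (p q, -β p) on centre and triangles with the common factor p = α - μ divided out,
  -- at q = 1. Its centre equation fails by `cofactor-α` up to sign; the leaf value is a default.
  eigenvalue-no-leaves : t ≡ 0 → μ ≈ α → cofactor-α k t α ≈ 0# → Eigenvalue
  eigenvalue-no-leaves t≡0 μ≈α c≈0 = eigenvalue-of-quotient 1# (- β) (- β) 0#
    (λ w≈0 → 0≉1 (sym (w≈0 v)))
    (begin
      α * ((⟨ 2 ⟩ * K + T) * 1#) + β * (K * - β + K * - β + T * 0#)
        ≈⟨ solve 4 (λ K T α μ → let I = con (+ 1); β = I :- α in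
             α :* ((con (+ 2) :* K :+ T) :* I) :+ β :* (K :* :- β :+ K :* :- β :+ T :* con (+ 0))
             := μ :* I :+ (:- I :* (con (+ 2) :* K :* (β :* β) :+ α :- con (+ 2) :* K :* α)
                           :+ α :* T :+ I :* (α :- μ))) refl K T α μ ⟩
      μ * 1# + (- 1# * cofactor-α k t α + α * T + 1# * (α - μ))
        ≈⟨ trans (+-congˡ (x,y≈0⇒x+y≈0 (x,y≈0⇒x+y≈0 (x≈0⇒y*x≈0 _ c≈0) (x≈0⇒y*x≈0 _ (n≡0⇒⟨n⟩≈0 t≡0)))
                                      (x≈0⇒y*x≈0 _ (α-μ≈0 μ≈α))))
                 (+-identityʳ _) ⟩
      μ * 1# ∎)
    at-triangle at-triangle
    (λ j → contradiction (≡.subst Fin t≡0 j) Fin.¬Fin0)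
    where
    at-triangle : α * ((1# + 1#) * - β) + β * (- β + 1#) ≈ μ * - β
    at-triangle = trans
      (solve 1 (λ α → let I = con (+ 1); β = I :- α in
         α :* ((I :+ I) :* :- β) :+ β :* (:- β :+ I) := α :* :- β) refl α)
      (*-congʳ (sym μ≈α))

  -- For β = 0 the matrix is diagonal with entry α at the leaves, so the indicator of the leaves is
  -- an eigenvector.
  eigenvalue-leaves : ¬ t ≡ 0 → μ ≈ α → β ≈ 0# → Eigenvalue
  eigenvalue-leaves t≢0 μ≈α β≈0 = eigenvalue-of-quotient 0# 0# 0# 1#
    (λ w≈0 → 0≉1 (sym (w≈0 (u (fromℕ< (ℕ.n≢0⇒n>0 t≢0))))))
    (begin
      α * ((⟨ 2 ⟩ * K + T) * 0#) + β * (K * 0# + K * 0# + T * 1#)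
        ≈⟨ solve 5 (λ α β K T μ → let O = con (+ 0); I = con (+ 1) in
             α :* ((con (+ 2) :* K :+ T) :* O) :+ β :* (K :* O :+ K :* O :+ T :* I)
             := μ :* O :+ T :* β) refl α β K T μ ⟩
      μ * 0# + T * β
        ≈⟨ trans (+-congˡ (x≈0⇒y*x≈0 _ β≈0)) (+-identityʳ _) ⟩
      μ * 0# ∎)
    at-triangle at-triangle
    (λ _ → trans (solve 2 (λ α β → α :* (con (+ 1) :* con (+ 1)) :+ β :* con (+ 0) := α :* con (+ 1))
                    refl α β)
                 (*-congʳ (sym μ≈α)))
    where
    at-triangle : α * ((1# + 1#) * 0#) + β * (0# + 0#) ≈ μ * 0#
    at-triangle = solve 3 (λ α β μ → let O = con (+ 0); I = con (+ 1) in
      α :* ((I :+ I) :* O) :+ β :* (O :+ O) := μ :* O) refl α β μ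

  -- Dividing (p q, -β q) on centre and leaves by q = α + 1 - μ and setting p = -1 gives (1, β) up
  -- to sign. Its centre equation fails by `cofactor-α+1`.
  eigenvalue-no-triangles : k ≡ 0 → μ ≈ α + 1# → cofactor-α+1 k t α ≈ 0# → Eigenvalue
  eigenvalue-no-triangles k≡0 μ≈α+1 c≈0 = eigenvalue 1# (const 0#) (const 0#) (const β)
    (λ w≈0 → 0≉1 (sym (w≈0 v)))
    (begin
      α * ((⟨ 2 ⟩ * K + T) * 1#) + β * (sum {k} (const 0#) + sum {k} (const 0#) + sum {t} (const β))
        ≈⟨ +-congˡ (*-congˡ (+-cong (+-cong 0s 0s) (sum-const {t} _ (λ _ → refl)))) ⟩
      α * ((⟨ 2 ⟩ * K + T) * 1#) + β * (0# + 0# + T * β)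
        ≈⟨ solve 4 (λ K T α μ → let I = con (+ 1); O = con (+ 0); β = I :- α in
             α :* ((con (+ 2) :* K :+ T) :* I) :+ β :* (O :+ O :+ T :* β)
             := μ :* I :+ (I :* (T :* (β :* β) :+ α :* T :- α :- I)
                           :+ con (+ 2) :* α :* K :+ I :* (α :+ I :- μ))) refl K T α μ ⟩
      μ * 1# + (1# * cofactor-α+1 k t α + ⟨ 2 ⟩ * α * K + 1# * (α + 1# - μ))
        ≈⟨ trans (+-congˡ (x,y≈0⇒x+y≈0 (x,y≈0⇒x+y≈0 (x≈0⇒y*x≈0 _ c≈0) (x≈0⇒y*x≈0 _ (n≡0⇒⟨n⟩≈0 k≡0)))
                                      (x≈0⇒y*x≈0 _ (α+1-μ≈0 μ≈α+1))))
                 (+-identityʳ _) ⟩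
      μ * 1# ∎)
    (λ i → contradiction (≡.subst Fin k≡0 i) Fin.¬Fin0)
    (λ i → contradiction (≡.subst Fin k≡0 i) Fin.¬Fin0)
    (λ _ → trans (solve 2 (λ α β → α :* (con (+ 1) :* β) :+ β :* con (+ 1)
                               := (α :+ con (+ 1)) :* β) refl α β)
                 (*-congʳ (sym μ≈α+1)))
    where
    0s = sum-zero {k} (const 0#) (λ _ → refl)

  -- The triangle and leaf equations hold identically in μ, and the centre equation fails by exactly
  -- χ.
  eigenvalue-generic : ¬ μ ≈ α → ¬ μ ≈ α + 1# → χ K T α μ ≈ 0# → Eigenvalue
  eigenvalue-generic μ≉α μ≉α+1 χ≈0 =
    eigenvalue-of-quotient ((α - μ) * (α + 1# - μ)) (- β * (α - μ)) (- β * (α - μ)) (- β * (α + 1# - μ))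
      (λ w≈0 → μ≉α+1 (sym (x-y≈0⇒x≈y _ _
        (x*y≈0⇒y≈0 (λ α-μ≈0 → μ≉α (sym (x-y≈0⇒x≈y _ _ α-μ≈0))) (w≈0 v)))))
      (begin
        α * ((⟨ 2 ⟩ * K + T) * ((α - μ) * (α + 1# - μ)))
        + β * (K * (- β * (α - μ)) + K * (- β * (α - μ)) + T * (- β * (α + 1# - μ)))
          ≈⟨ solve 4 (λ K T α μ → let β = con (+ 1) :- α; p = α :- μ; q = α :+ con (+ 1) :- μ in
               α :* ((con (+ 2) :* K :+ T) :* (p :* q))
               :+ β :* (K :* (:- β :* p) :+ K :* (:- β :* p) :+ T :* (:- β :* q))
               := μ :* (p :* q) :+ ((α :* (con (+ 2) :* K :+ T) :- μ) :* q :* p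
                  :- con (+ 2) :* K :* (β :* β) :* p :- T :* (β :* β) :* q)) refl K T α μ ⟩
        μ * ((α - μ) * (α + 1# - μ)) + χ K T α μ
          ≈⟨ trans (+-congˡ χ≈0) (+-identityʳ _) ⟩
        μ * ((α - μ) * (α + 1# - μ)) ∎)
      at-triangle at-triangle
      (λ _ → solve 2 (λ α μ → let β = con (+ 1) :- α; p = α :- μ; q = α :+ con (+ 1) :- μ in
        α :* (con (+ 1) :* (:- β :* q)) :+ β :* (p :* q) := μ :* (:- β :* q)) refl α μ)
    where
    at-triangle : α * ((1# + 1#) * (- β * (α - μ))) + β * (- β * (α - μ) + (α - μ) * (α + 1# - μ))
                ≈ μ * (- β * (α - μ))
    at-triangle = solve 2 (λ α μ → let β = con (+ 1) :- α; p = α :- μ; q = α :+ con (+ 1) :- μ in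
      α :* ((con (+ 1) :+ con (+ 1)) :* (:- β :* p)) :+ β :* (:- β :* p :+ p :* q)
      := μ :* (:- β :* p)) refl α μ

  eigenvalue-genuine : IsGenuineRoot k t n α μ → Eigenvalue
  eigenvalue-genuine (f≈0 , multiple) with μ ≈? α | μ ≈? α + 1# | t ℕ.≟ 0 | k ℕ.≟ 0
  ... | yes μ≈α | _ | yes t≡0 | _ = eigenvalue-no-leaves t≡0 μ≈α
    (multiple⇒c≈0 α _ _ (f-at-α k t α (n≡0⇒⟨n⟩≈0 t≡0))
      (IsMultipleRoot-resp-≈ μ≈α (multiple (inj₁ (t≡0 , μ≈α)))))
  ... | yes μ≈α | _ | no t≢0 | _ = eigenvalue-leaves t≢0 μ≈α
    (leaves⇒β≈0 t≢0 μ≈α (trans (sym (f≈χ k t α μ)) f≈0))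
  ... | no _ | yes μ≈α+1 | _ | yes k≡0 = eigenvalue-no-triangles k≡0 μ≈α+1
    (multiple⇒c≈0 (α + 1#) _ _ (f-at-α+1 k t α (n≡0⇒⟨n⟩≈0 k≡0))
      (IsMultipleRoot-resp-≈ μ≈α+1 (multiple (inj₂ (k≡0 , μ≈α+1)))))
  -- With triangles present, a root α + 1 forces α = 1, where it coincides with 3α - 1 and a single
  -- triangle carries an eigenvector.
  ... | no _ | yes μ≈α+1 | _ | no k≢0 = eigenvalue-3α-1 (ℕ.n≢0⇒n>0 k≢0)
    (trans μ≈α+1 (α+1≈3α-1 (triangles⇒β≈0 k≢0 μ≈α+1 (trans (sym (f≈χ k t α μ)) f≈0))))
  ... | no μ≉α | no μ≉α+1 | _ | _ = eigenvalue-generic μ≉α μ≉α+1 (trans (sym (f≈χ k t α μ)) f≈0)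

-- From eigenvectors to the listed values.

module EigenvalueAnalysis {ℓ} (ℝ : CompleteOrderedField ℓ) (k t : ℕ)
  (α μ : CompleteOrderedField.Carrier ℝ) where
  open CompleteOrderedField ℝ hiding (zero)
  open Spectral ℝ
  open IntegerCoefficients commutativeRing
  open Summation commutativeRing
  open OrderedField ℝ
  open CharacteristicPolynomial ℝ
  open FriendshipWithPendants k t
  open FriendshipMatrix ℝ k t
  open SetoidReasoning setoid

  private
    n : ℕ
    n = 2 ℕ.* k ℕ.+ t ℕ.+ 1

    K T β : Carrier
    K = ⟨ k ⟩
    T = ⟨ t ⟩
    β = 1# - α

  module _ (w : Vertex → Carrier) (eigen : ∀ x → (A[_] graph α *ᵍ w) x ≈ μ * w x) where

    private
      a S₁ S′ S Z : Carrier
      a  = w v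
      S₁ = sum (w ∘ v₁)
      S′ = sum (w ∘ v′)
      S  = S₁ + S′
      Z  = sum (w ∘ u)

    centre≈0 : α * ((⟨ 2 ⟩ * K + T) * a) + β * (S + Z) - μ * a ≈ 0#
    centre≈0 = x≈y⇒x-y≈0 (trans (sym (A-v α w)) (eigen v))

    v₁≈0 : ∀ i → α * ((1# + 1#) * w (v₁ i)) + β * (w (v′ i) + a) - μ * w (v₁ i) ≈ 0#
    v₁≈0 i = x≈y⇒x-y≈0 (trans (sym (A-v₁ α w i)) (eigen (v₁ i)))

    v′≈0 : ∀ i → α * ((1# + 1#) * w (v′ i)) + β * (w (v₁ i) + a) - μ * w (v′ i) ≈ 0#
    v′≈0 i = x≈y⇒x-y≈0 (trans (sym (A-v′ α w i)) (eigen (v′ i)))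

    leaf : ∀ j → (μ - α) * w (u j) ≈ β * a
    leaf j = begin
      (μ - α) * w (u j)
        ≈⟨ solve 5 (λ α β μ z a → (μ :- α) :* z
             := β :* a :+ :- con (+ 1) :* (α :* (con (+ 1) :* z) :+ β :* a :- μ :* z))
             refl α β μ (w (u j)) a ⟩
      β * a + - 1# * (α * (1# * w (u j)) + β * a - μ * w (u j))
        ≈⟨ trans (+-congˡ (x≈0⇒y*x≈0 _ (x≈y⇒x-y≈0 (trans (sym (A-u α w j)) (eigen (u j))))))
                 (+-identityʳ _) ⟩
      β * a ∎

    -- The sum of the two equations of a triangle; subtracting them, as in `pair-difference`,
    -- cancels the centre instead.
    pair-sum : ∀ i → (μ - (α + 1#)) * (w (v₁ i) + w (v′ i)) ≈ ⟨ 2 ⟩ * (β * a)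
    pair-sum i = begin
      (μ - (α + 1#)) * (w (v₁ i) + w (v′ i))
        ≈⟨ solve 5 (λ α μ x y a → let I = con (+ 1); β = I :- α in
             (μ :- (α :+ I)) :* (x :+ y) := con (+ 2) :* (β :* a)
             :+ (:- I :* (α :* ((I :+ I) :* x) :+ β :* (y :+ a) :- μ :* x)
                 :+ :- I :* (α :* ((I :+ I) :* y) :+ β :* (x :+ a) :- μ :* y)))
             refl α μ (w (v₁ i)) (w (v′ i)) a ⟩
      ⟨ 2 ⟩ * (β * a) + (- 1# * _ + - 1# * _)
        ≈⟨ trans (+-congˡ (x,y≈0⇒x+y≈0 (x≈0⇒y*x≈0 _ (v₁≈0 i)) (x≈0⇒y*x≈0 _ (v′≈0 i))))
                 (+-identityʳ _) ⟩
      ⟨ 2 ⟩ * (β * a) ∎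

    pair-difference : ∀ i → (w (v₁ i) - w (v′ i)) * (μ - (⟨ 3 ⟩ * α - 1#)) ≈ 0#
    pair-difference i = begin
      (w (v₁ i) - w (v′ i)) * (μ - (⟨ 3 ⟩ * α - 1#))
        ≈⟨ solve 5 (λ α μ x y a → let I = con (+ 1); β = I :- α in
             (x :- y) :* (μ :- (con (+ 3) :* α :- I)) :=
             :- I :* (α :* ((I :+ I) :* x) :+ β :* (y :+ a) :- μ :* x)
             :+ I :* (α :* ((I :+ I) :* y) :+ β :* (x :+ a) :- μ :* y))
             refl α μ (w (v₁ i)) (w (v′ i)) a ⟩
      - 1# * _ + 1# * _
        ≈⟨ x,y≈0⇒x+y≈0 (x≈0⇒y*x≈0 _ (v₁≈0 i)) (x≈0⇒y*x≈0 _ (v′≈0 i)) ⟩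
      0# ∎

    leaves≈0 : (μ - α) * Z - T * (β * a) ≈ 0#
    leaves≈0 = x≈y⇒x-y≈0 (trans (*-distribˡ-sum (μ - α) (w ∘ u)) (sum-const _ leaf))

    triangles≈0 : (μ - (α + 1#)) * S - K * (⟨ 2 ⟩ * (β * a)) ≈ 0#
    triangles≈0 = x≈y⇒x-y≈0 (begin
      (μ - (α + 1#)) * S
        ≈⟨ *-congˡ (∑-distrib-+ (w ∘ v₁) (w ∘ v′)) ⟨
      (μ - (α + 1#)) * sum (λ i → w (v₁ i) + w (v′ i))
        ≈⟨ *-distribˡ-sum (μ - (α + 1#)) (λ i → w (v₁ i) + w (v′ i)) ⟩
      sum (λ i → (μ - (α + 1#)) * (w (v₁ i) + w (v′ i)))
        ≈⟨ sum-const _ pair-sum ⟩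
      K * (⟨ 2 ⟩ * (β * a)) ∎)

    -- Cramer's rule: with p = α - μ and q = α + 1 - μ, the multipliers q p, β p and β q of the
    -- centre, triangle and leaf equations eliminate `S` and `Z`.
    χ*a≈0 : a * χ K T α μ ≈ 0#
    χ*a≈0 = begin
      a * χ K T α μ
        ≈⟨ solve 7 (λ K T α μ a S Z → let β = con (+ 1) :- α; p = α :- μ; q = α :+ con (+ 1) :- μ in
             a :* ((α :* (con (+ 2) :* K :+ T) :- μ) :* q :* p
                   :- con (+ 2) :* K :* (β :* β) :* p :- T :* (β :* β) :* q)
             := q :* p :* (α :* ((con (+ 2) :* K :+ T) :* a) :+ β :* (S :+ Z) :- μ :* a)
                :+ β :* p :* ((μ :- (α :+ con (+ 1))) :* S :- K :* (con (+ 2) :* (β :* a)))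
                :+ β :* q :* ((μ :- α) :* Z :- T :* (β :* a))) refl K T α μ a S Z ⟩
      (α + 1# - μ) * (α - μ) * _ + β * (α - μ) * _ + β * (α + 1# - μ) * _
        ≈⟨ x,y≈0⇒x+y≈0 (x,y≈0⇒x+y≈0 (x≈0⇒y*x≈0 _ centre≈0) (x≈0⇒y*x≈0 _ triangles≈0))
                       (x≈0⇒y*x≈0 _ leaves≈0) ⟩
      0# ∎

    -- The elimination of `χ*a≈0` would lose everything to the factor p = 0. Dividing it out of q p
    -- and β p at q = 1 gives the multipliers 1 and β, used here with opposite sign.
    no-leaves : t ≡ 0 → μ ≈ α → a * cofactor-α k t α ≈ 0#
    no-leaves t≡0 μ≈α = begin
      a * cofactor-α k t α
        ≈⟨ solve 7 (λ K T α μ a S Z → let I = con (+ 1); β = I :- α in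
             a :* (con (+ 2) :* K :* (β :* β) :+ α :- con (+ 2) :* K :* α)
             := :- I :* (α :* ((con (+ 2) :* K :+ T) :* a) :+ β :* (S :+ Z) :- μ :* a)
                :+ :- β :* ((μ :- (α :+ I)) :* S :- K :* (con (+ 2) :* (β :* a)))
                :+ (β :* S :- a) :* (μ :- α)
                :+ α :* a :* T
                :+ β :* Z) refl K T α μ a S Z ⟩
      - 1# * _ + - β * _ + (β * S - a) * (μ - α) + α * a * T + β * Z
        ≈⟨ x,y≈0⇒x+y≈0 (x,y≈0⇒x+y≈0 (x,y≈0⇒x+y≈0 (x,y≈0⇒x+y≈0
             (x≈0⇒y*x≈0 _ centre≈0) (x≈0⇒y*x≈0 _ triangles≈0)) (x≈0⇒y*x≈0 _ (x≈y⇒x-y≈0 μ≈α)))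
             (x≈0⇒y*x≈0 _ (n≡0⇒⟨n⟩≈0 t≡0))) (x≈0⇒y*x≈0 _ (sum-empty t≡0 (w ∘ u))) ⟩
      0# ∎

    -- Likewise q = 0 is divided out of q p and β q; at p = -1 the multipliers are -1 and β, used
    -- with opposite sign.
    no-triangles : k ≡ 0 → μ ≈ α + 1# → a * cofactor-α+1 k t α ≈ 0#
    no-triangles k≡0 μ≈α+1 = begin
      a * cofactor-α+1 k t α
        ≈⟨ solve 7 (λ K T α μ a S Z → let I = con (+ 1); β = I :- α in
             a :* (T :* (β :* β) :+ α :* T :- α :- I)
             := I :* (α :* ((con (+ 2) :* K :+ T) :* a) :+ β :* (S :+ Z) :- μ :* a)
                :+ :- β :* ((μ :- α) :* Z :- T :* (β :* a))
                :+ (a :+ β :* Z) :* (μ :- (α :+ I))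
                :+ :- con (+ 2) :* α :* a :* K
                :+ :- β :* S) refl K T α μ a S Z ⟩
      1# * _ + - β * _ + (a + β * Z) * (μ - (α + 1#)) + - ⟨ 2 ⟩ * α * a * K + - β * S
        ≈⟨ x,y≈0⇒x+y≈0 (x,y≈0⇒x+y≈0 (x,y≈0⇒x+y≈0 (x,y≈0⇒x+y≈0
             (x≈0⇒y*x≈0 _ centre≈0) (x≈0⇒y*x≈0 _ leaves≈0)) (x≈0⇒y*x≈0 _ (x≈y⇒x-y≈0 μ≈α+1)))
             (x≈0⇒y*x≈0 _ (n≡0⇒⟨n⟩≈0 k≡0)))
             (x≈0⇒y*x≈0 _ (x,y≈0⇒x+y≈0 (sum-empty k≡0 (w ∘ v₁)) (sum-empty k≡0 (w ∘ v′)))) ⟩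
      0# ∎

    centre≉0⇒genuine : ¬ a ≈ 0# → IsGenuineRoot k t n α μ
    centre≉0⇒genuine a≉0 = trans (f≈χ k t α μ) (x*y≈0⇒y≈0 a≉0 χ*a≈0) , λ where
      (inj₁ (t≡0 , μ≈α)) → IsMultipleRoot-resp-≈ (sym μ≈α)
        (c≈0⇒multiple α _ _ (f-at-α k t α (n≡0⇒⟨n⟩≈0 t≡0)) (x*y≈0⇒y≈0 a≉0 (no-leaves t≡0 μ≈α)))
      (inj₂ (k≡0 , μ≈α+1)) → IsMultipleRoot-resp-≈ (sym μ≈α+1)
        (c≈0⇒multiple (α + 1#) _ _ (f-at-α+1 k t α (n≡0⇒⟨n⟩≈0 k≡0))
          (x*y≈0⇒y≈0 a≉0 (no-triangles k≡0 μ≈α+1)))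

    module _ (a≈0 : a ≈ 0#) where

      -- With zero at the centre, its equation reduces to β (S + Z) = 0. The parameter `s` stands
      -- for the value of the sum on a known support.
      S+Z≈0⇒β≈0 : ∀ {s} → S + Z ≈ s → ¬ s ≈ 0# → β ≈ 0#
      S+Z≈0⇒β≈0 {s} S+Z≈s s≉0 = x*y≈0⇒y≈0 s≉0 (begin
        s * β
          ≈⟨ *-congʳ S+Z≈s ⟨
        (S + Z) * β
          ≈⟨ solve 6 (λ α β d μ a s → s :* β
               := con (+ 1) :* (α :* (d :* a) :+ β :* s :- μ :* a) :+ (μ :- α :* d) :* a)
               refl α β (⟨ 2 ⟩ * K + T) μ a (S + Z) ⟩
        1# * _ + (μ - α * (⟨ 2 ⟩ * K + T)) * a
          ≈⟨ x,y≈0⇒x+y≈0 (x≈0⇒y*x≈0 _ centre≈0) (x≈0⇒y*x≈0 _ a≈0) ⟩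
        0# ∎)

      leaf≉0⇒μ≈α : ∀ j → ¬ w (u j) ≈ 0# → μ ≈ α
      leaf≉0⇒μ≈α j z≉0 = x-y≈0⇒x≈y _ _ (x*y≈0⇒y≈0 z≉0
        (trans (*-comm _ _) (trans (leaf j) (x≈0⇒y*x≈0 β a≈0))))

      -- Here t = 1 and μ = α. The centre equation forces β = 0, so χ vanishes at α; neither
      -- condition for a spurious root can hold, as a leaf exists and α differs from α + 1.
      single-leaf⇒genuine : t ℕ.< 2 → ∀ j → ¬ w (u j) ≈ 0# → IsGenuineRoot k t n α μ
      single-leaf⇒genuine t<2 j z≉0 = (begin
          f n t α μ                       ≈⟨ f≈χ k t α μ ⟩
          χ K T α μ                       ≈⟨ χ-near-α K T α μ ⟩
          _ * (α - μ) - T * (β * β)       ≈⟨ +-cong (x≈0⇒y*x≈0 _ α-μ≈0)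
                                                    (-‿cong (x≈0⇒y*x≈0 T (x≈0⇒y*x≈0 β β≈0))) ⟩
          0# - 0#                         ≈⟨ -‿inverseʳ 0# ⟩
          0#                              ∎)
        , λ where
          (inj₁ (t≡0 , _))   → contradiction (≡.subst Fin t≡0 j) Fin.¬Fin0
          (inj₂ (_ , μ≈α+1)) → contradiction (trans (sym μ≈α) μ≈α+1) (x≉x+1 α)
        where
        μ≈α : μ ≈ α
        μ≈α = leaf≉0⇒μ≈α j z≉0

        α-μ≈0 : α - μ ≈ 0#
        α-μ≈0 = x≈y⇒x-y≈0 (sym μ≈α)

        -- At μ = α the factor μ - (α + 1) is -1, so the summed triangle equation determines `S`
        -- from the vanishing centre value.
        S≈0 : S ≈ 0#
        S≈0 = begin
          S ≈⟨ solve 6 (λ K β α μ a S → S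
                 := (S :* (μ :- α) :+ :- con (+ 1) :* ((μ :- (α :+ con (+ 1))) :* S :- K :* (con (+ 2) :* (β :* a))))
                    :+ :- (K :* (con (+ 2) :* β)) :* a) refl K β α μ a S ⟩
          (S * (μ - α) + - 1# * _) + - (K * (⟨ 2 ⟩ * β)) * a
            ≈⟨ x,y≈0⇒x+y≈0 (x,y≈0⇒x+y≈0 (x≈0⇒y*x≈0 _ (x≈y⇒x-y≈0 μ≈α)) (x≈0⇒y*x≈0 _ triangles≈0))
                           (x≈0⇒y*x≈0 _ a≈0) ⟩
          0# ∎

        β≈0 : β ≈ 0#
        β≈0 = S+Z≈0⇒β≈0 (trans (+-cong S≈0 (sum-subsingleton t<2 (w ∘ u) j)) (+-identityˡ _)) z≉0

      module _ (z≈0 : ∀ j → w (u j) ≈ 0#) where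

        pair≉⇒μ≈3α-1 : ∀ i → ¬ w (v₁ i) ≈ w (v′ i) → μ ≈ ⟨ 3 ⟩ * α - 1#
        pair≉⇒μ≈3α-1 i x≉y = x-y≈0⇒x≈y _ _
          (x*y≈0⇒y≈0 (x≉y ∘ x-y≈0⇒x≈y _ _) (pair-difference i))

        module _ (x≈y : ∀ i → w (v₁ i) ≈ w (v′ i)) (i : Fin k) (x≉0 : ¬ w (v₁ i) ≈ 0#) where

          x+y≉0 : ¬ w (v₁ i) + w (v′ i) ≈ 0#
          x+y≉0 x+y≈0 = x≉0 (x*y≈0⇒y≈0 (⟨1+n⟩≉0 1) (begin
            ⟨ 2 ⟩ * w (v₁ i)
              ≈⟨ solve 1 (λ x → con (+ 2) :* x := x :+ x) refl (w (v₁ i)) ⟩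
            w (v₁ i) + w (v₁ i)     ≈⟨ +-congˡ (x≈y i) ⟩
            w (v₁ i) + w (v′ i)     ≈⟨ x+y≈0 ⟩
            0#                      ∎))

          pair≉0⇒μ≈α+1 : μ ≈ α + 1#
          pair≉0⇒μ≈α+1 = x-y≈0⇒x≈y _ _ (x*y≈0⇒y≈0 x+y≉0
            (trans (*-comm _ _) (trans (pair-sum i) (x≈0⇒y*x≈0 ⟨ 2 ⟩ (x≈0⇒y*x≈0 β a≈0)))))

          single-triangle⇒β≈0 : k ℕ.< 2 → β ≈ 0#
          single-triangle⇒β≈0 k<2 = S+Z≈0⇒β≈0
            (trans (+-cong (+-cong (sum-subsingleton k<2 (w ∘ v₁) i) (sum-subsingleton k<2 (w ∘ v′) i))
                           (sum-zero (w ∘ u) z≈0))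
                   (+-identityʳ _))
            x+y≉0

  -- The tests look for a nonzero entry in turn: the centre, a leaf, the difference of a pair, the
  -- common value of a pair. If all fail, the vector is zero.
  eigenvalue⇒ : IsEigenvalue graph (A[_] graph α) μ →
      (2 ℕ.≤ t × μ ≈ α)
    ⊎ (2 ℕ.≤ k × μ ≈ α + 1#)
    ⊎ (1 ℕ.≤ k × μ ≈ ⟨ 3 ⟩ * α - 1#)
    ⊎ IsGenuineRoot k t n α μ
  eigenvalue⇒ (w , w≉0 , eigen) with w v ≈? 0#
  ... | no  a≉0 = inj₂ (inj₂ (inj₂ (centre≉0⇒genuine w eigen a≉0)))
  ... | yes a≈0 with Fin.all? (λ j → w (u j) ≈? 0#)
  ...   | no ¬z≈0 with Fin.¬∀⟶∃¬ t _ (λ j → w (u j) ≈? 0#) ¬z≈0 | 2 ℕ.≤? t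
  ...     | j , z≉0 | yes 2≤t = inj₁ (2≤t , leaf≉0⇒μ≈α w eigen a≈0 j z≉0)
  ...     | j , z≉0 | no  2≰t =
    inj₂ (inj₂ (inj₂ (single-leaf⇒genuine w eigen a≈0 (ℕ.≰⇒> 2≰t) j z≉0)))
  eigenvalue⇒ (w , w≉0 , eigen) | yes a≈0 | yes z≈0
    with Fin.all? (λ i → w (v₁ i) ≈? w (v′ i))
  ...   | no ¬x≈y with i , x≉y ← Fin.¬∀⟶∃¬ k _ (λ i → w (v₁ i) ≈? w (v′ i)) ¬x≈y =
    inj₂ (inj₂ (inj₁ (ℕ.≤-<-trans z≤n (Fin.toℕ<n i) , pair≉⇒μ≈3α-1 w eigen a≈0 z≈0 i x≉y)))
  ...   | yes x≈y with Fin.all? (λ i → w (v₁ i) ≈? 0#)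
  ...     | yes x≈0 = contradiction
    (λ where v      → a≈0
             (v₁ i) → x≈0 i
             (v′ i) → trans (sym (x≈y i)) (x≈0 i)
             (u j)  → z≈0 j) w≉0
  ...     | no ¬x≈0 with Fin.¬∀⟶∃¬ k _ (λ i → w (v₁ i) ≈? 0#) ¬x≈0 | 2 ℕ.≤? k
  ...       | i , x≉0 | yes 2≤k = inj₂ (inj₁ (2≤k , pair≉0⇒μ≈α+1 w eigen a≈0 z≈0 x≈y i x≉0))
  -- A lone triangle with equal values forces α = 1, so μ = α + 1 is listed as 3α - 1.
  ...       | i , x≉0 | no  2≰k = inj₂ (inj₂ (inj₁ (ℕ.≤-<-trans z≤n (Fin.toℕ<n i) ,
    trans (pair≉0⇒μ≈α+1 w eigen a≈0 z≈0 x≈y i x≉0)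
          (α+1≈3α-1 (single-triangle⇒β≈0 w eigen a≈0 z≈0 x≈y i x≉0 (ℕ.≰⇒> 2≰k))))))

theorem8 :
    ∀ {ℓ} (ℝ : CompleteOrderedField ℓ) (k t : ℕ) →
    let open CompleteOrderedField ℝ
        open Spectral ℝ
        n = 2 ℕ.* k ℕ.+ t ℕ.+ 1
        G = Cᶜ k t
    in
    (α : Carrier) → 0# ≤ α → α ≤ 1# → (μ : Carrier) →
    IsEigenvalue G (A[_] G α) μ ⇔
      ( (2 ℕ.≤ t × μ ≈ α)
      ⊎ (2 ℕ.≤ k × μ ≈ α + 1#)
      ⊎ (1 ℕ.≤ k × μ ≈ ⟨ 3 ⟩ * α - 1#)
      ⊎ IsGenuineRoot k t n α μ )
theorem8 ℝ k t α _ _ μ = mk⇔ eigenvalue⇒ λ where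
    (inj₁ (2≤t , μ≈α))                    → eigenvalue-α 2≤t μ≈α
    (inj₂ (inj₁ (2≤k , μ≈α+1)))           → eigenvalue-α+1 2≤k μ≈α+1
    (inj₂ (inj₂ (inj₁ (1≤k , μ≈3α-1))))   → eigenvalue-3α-1 1≤k μ≈3α-1
    (inj₂ (inj₂ (inj₂ genuine)))          → eigenvalue-genuine genuine
  where
  open EigenvalueConstruction ℝ k t α μ
  open EigenvalueAnalysis ℝ k t α μ
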